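{- Let $\beta\geq 2$ be an integer. Then there are only finitely many pairwise non-isomorphic Shilla distance-regular graphs $\Gamma$ with $b(\Gamma)=\beta$.
   Context: A connected graph $\Gamma$ of diameter $D$ is distance-regular if there are integers $b_i,c_i$ ($0\le i\le D$) such that for any two vertices $x,y$ at distance $i$, exactly $c_i$ neighbours of $y$ are at distance $i-1$ from $x$ and exactly $b_i$ neighbours of $y$ are at distance $i+1$ from $x$. Then $\Gamma$ is regular of valency $k=b_0$, and $a_i:=k-b_i-c_i$. The eigenvalues of $\Gamma$ are those of its adjacency matrix; $\Gamma$ has exactly $D+1$ distinct eigenvalues $k=\theta_0>\theta_1>\dots>\theta_D$. A Shilla distance-regular graph is a distance-regular graph of diameter $3$ whose second largest eigenvalue satisfies $\theta_1=a_3$. For such graphs $k=(a_3-a_1)a_3$, and one defines $b(\Gamma):=a_3-a_1=k/a_3$. -}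

module Defs where

open import Data.Bool.Base using (Bool; true; false; T; if_then_else_)
open import Data.Bool.Properties using (T?)
open import Data.Fin.Base using (Fin; zero; suc; toℕ)
import Data.Fin.Properties as Fin
open import Data.Integer.Base as ℤ using (ℤ; +_)
open import Data.List.Base using (List; length; filter; allFin)
open import Data.List.Relation.Unary.Any using (Any)
open import Data.Nat.Base as ℕ using (ℕ; zero; suc)
import Data.Nat.Properties as ℕ
open import Data.Product.Base using (Σ; ∃; ∃₂; ∃-syntax; _×_; _,_)
open import Data.Rational.Base as ℚ using (ℚ; 0ℚ; 1ℚ; ∣_∣)
import Data.Rational.Properties as ℚ
open import Data.Rational.Solver using (module +-*-Solver)
open import Data.Vec.Functional using (Vector; foldr)
open import Function.Base using (_∘_)
open import Function.Bundles using (_↔_; Inverse)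
open import Relation.Binary.PropositionalEquality
  using (_≡_; refl; sym; trans; cong; cong₂; subst)
open import Relation.Nullary.Decidable using (Dec; ¬?; _×-dec_)
open import Relation.Nullary.Negation using (¬_)

open +-*-Solver using (solve; _:=_; _:+_; _:-_; _:*_)

-- Real numbers as Cauchy sequences of rationals; equality is _≃_.
record ℝ : Set where
  constructor mkℝ
  field
    seq    : ℕ → ℚ
    cauchy : ∀ ε → 0ℚ ℚ.< ε →
             ∃[ N ] (∀ m n → N ℕ.≤ m → N ℕ.≤ n → ∣ seq m ℚ.- seq n ∣ ℚ.≤ ε)

open ℝ public

infix 4 _≃_ _<_

_≃_ : ℝ → ℝ → Set
x ≃ y = ∀ ε → 0ℚ ℚ.< ε →
        ∃[ N ] (∀ n → N ℕ.≤ n → ∣ seq x n ℚ.- seq y n ∣ ℚ.≤ ε)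

_<_ : ℝ → ℝ → Set
x < y = ∃₂ λ ε N → 0ℚ ℚ.< ε × (∀ n → N ℕ.≤ n → seq x n ℚ.+ ε ℚ.≤ seq y n)

fromℚ : ℚ → ℝ
fromℚ q .seq _ = q
fromℚ q .cauchy ε 0<ε = 0 , λ _ _ _ _ →
  subst (ℚ._≤ ε) (sym (cong ∣_∣ (ℚ.+-inverseʳ q))) (ℚ.<⇒≤ 0<ε)

fromℤ : ℤ → ℝ
fromℤ i = fromℚ (i ℚ./ 1)

0ℝ 1ℝ : ℝ
0ℝ = fromℚ 0ℚ
1ℝ = fromℚ 1ℚ

-- Arguments are explicit because rational arithmetic unfolds too eagerly for
-- them to be inferred.

shrink : ∀ B ε → 0ℚ ℚ.< B → 0ℚ ℚ.< ε → ∃[ δ ] (0ℚ ℚ.< δ × B ℚ.* δ ≡ ε)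
shrink B ε 0<B 0<ε = δ , ℚ.positive⁻¹ δ {{pos}} , eq
  where
  instance
    B⁺ = ℚ.positive 0<B
    ε⁺ = ℚ.positive 0<ε
    B≢0 = ℚ.pos⇒nonZero B
  1/B = ℚ.1/ B
  δ   = 1/B ℚ.* ε
  pos = ℚ.pos*pos⇒pos 1/B {{ℚ.1/pos⇒pos B}} ε
  eq : B ℚ.* δ ≡ ε
  eq = trans (sym (ℚ.*-assoc B 1/B ε))
         (trans (cong (ℚ._* ε) (ℚ.*-inverseʳ B)) (ℚ.*-identityˡ ε))

∣q∣≤∣q-p∣+∣p∣ : ∀ p q → ∣ q ∣ ℚ.≤ ∣ q ℚ.- p ∣ ℚ.+ ∣ p ∣
∣q∣≤∣q-p∣+∣p∣ p q =
  subst (λ r → ∣ r ∣ ℚ.≤ ∣ q ℚ.- p ∣ ℚ.+ ∣ p ∣) (split p q) (ℚ.∣p+q∣≤∣p∣+∣q∣ (q ℚ.- p) p)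
  where
  split : ∀ p q → (q ℚ.- p) ℚ.+ p ≡ q
  split = solve 2 (λ p q → (q :- p) :+ p := q) refl

∣*∣-mono-≤ : ∀ p q B δ → ∣ p ∣ ℚ.≤ B → ∣ q ∣ ℚ.≤ δ → 0ℚ ℚ.≤ δ → ∣ p ℚ.* q ∣ ℚ.≤ B ℚ.* δ
∣*∣-mono-≤ p q B δ p≤B q≤δ 0≤δ =
  subst (ℚ._≤ B ℚ.* δ) (sym (ℚ.∣p*q∣≡∣p∣*∣q∣ p q))
    (ℚ.≤-trans {∣ p ∣ ℚ.* ∣ q ∣} {∣ p ∣ ℚ.* δ} {B ℚ.* δ}
      (ℚ.*-monoˡ-≤-nonNeg ∣ p ∣ {{ℚ.nonNegative (ℚ.0≤∣p∣ p)}} {∣ q ∣} {δ} q≤δ)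
      (ℚ.*-monoʳ-≤-nonNeg δ {{ℚ.nonNegative 0≤δ}} {∣ p ∣} {B} p≤B))

∣+∣-mono-≤ : ∀ p q α β → ∣ p ∣ ℚ.≤ α → ∣ q ∣ ℚ.≤ β → ∣ p ℚ.+ q ∣ ℚ.≤ α ℚ.+ β
∣+∣-mono-≤ p q α β p≤α q≤β =
  ℚ.≤-trans {∣ p ℚ.+ q ∣} {∣ p ∣ ℚ.+ ∣ q ∣} {α ℚ.+ β}
    (ℚ.∣p+q∣≤∣p∣+∣q∣ p q)
    (ℚ.+-mono-≤ {∣ p ∣} {α} {∣ q ∣} {β} p≤α q≤β)

∣+∣-close : ∀ p q r s α β → ∣ p ℚ.- r ∣ ℚ.≤ α → ∣ q ℚ.- s ∣ ℚ.≤ β →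
            ∣ (p ℚ.+ q) ℚ.- (r ℚ.+ s) ∣ ℚ.≤ α ℚ.+ β
∣+∣-close p q r s α β p≈r q≈s =
  subst (λ t → ∣ t ∣ ℚ.≤ α ℚ.+ β) (split p q r s)
    (∣+∣-mono-≤ (p ℚ.- r) (q ℚ.- s) α β p≈r q≈s)
  where
  split : ∀ p q r s → (p ℚ.- r) ℚ.+ (q ℚ.- s) ≡ (p ℚ.+ q) ℚ.- (r ℚ.+ s)
  split = solve 4 (λ p q r s → (p :- r) :+ (q :- s) := (p :+ q) :- (r :+ s)) refl

∣*∣-close : ∀ p q r s B C δ → ∣ p ∣ ℚ.≤ B → ∣ s ∣ ℚ.≤ C → 0ℚ ℚ.≤ δ →
            ∣ p ℚ.- r ∣ ℚ.≤ δ → ∣ q ℚ.- s ∣ ℚ.≤ δ →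
            ∣ p ℚ.* q ℚ.- r ℚ.* s ∣ ℚ.≤ (B ℚ.+ C) ℚ.* δ
∣*∣-close p q r s B C δ p≤B s≤C 0≤δ p≈r q≈s =
  subst (∣ p ℚ.* q ℚ.- r ℚ.* s ∣ ℚ.≤_) (sym (ℚ.*-distribʳ-+ δ B C))
    (subst (λ t → ∣ t ∣ ℚ.≤ B ℚ.* δ ℚ.+ C ℚ.* δ) (split p q r s)
      (∣+∣-mono-≤ (p ℚ.* (q ℚ.- s)) (s ℚ.* (p ℚ.- r)) (B ℚ.* δ) (C ℚ.* δ)
        (∣*∣-mono-≤ p (q ℚ.- s) B δ p≤B q≈s 0≤δ)
        (∣*∣-mono-≤ s (p ℚ.- r) C δ s≤C p≈r 0≤δ)))
  where
  split : ∀ p q r s → p ℚ.* (q ℚ.- s) ℚ.+ s ℚ.* (p ℚ.- r) ≡ p ℚ.* q ℚ.- r ℚ.* s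
  split = solve 4 (λ p q r s → p :* (q :- s) :+ s :* (p :- r) := p :* q :- r :* s) refl

bounded : ∀ x → ∃₂ λ B N → 0ℚ ℚ.< B × (∀ n → N ℕ.≤ n → ∣ seq x n ∣ ℚ.≤ B)
bounded x with cauchy x 1ℚ (ℚ.positive⁻¹ 1ℚ)
... | N , close = 1ℚ ℚ.+ p , N , 0<B , λ n N≤n →
  ℚ.≤-trans {∣ seq x n ∣} {∣ seq x n ℚ.- seq x N ∣ ℚ.+ p} {1ℚ ℚ.+ p}
    (∣q∣≤∣q-p∣+∣p∣ (seq x N) (seq x n))
    (ℚ.+-monoˡ-≤ p {∣ seq x n ℚ.- seq x N ∣} {1ℚ} (close n N N≤n ℕ.≤-refl))
  where
  p = ∣ seq x N ∣
  0<B : 0ℚ ℚ.< 1ℚ ℚ.+ p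
  0<B = ℚ.+-mono-<-≤ {0ℚ} {1ℚ} {0ℚ} {p} (ℚ.positive⁻¹ 1ℚ) (ℚ.0≤∣p∣ (seq x N))

infixl 6 _+_
infixl 7 _*_

_+_ : ℝ → ℝ → ℝ
(x + y) .seq n = seq x n ℚ.+ seq y n
(x + y) .cauchy ε 0<ε =
  let δ , 0<δ , 2δ≡ε = shrink (1ℚ ℚ.+ 1ℚ) ε (ℚ.positive⁻¹ (1ℚ ℚ.+ 1ℚ)) 0<ε
      δ+δ≡ε = trans (sym (cong₂ ℚ._+_ (ℚ.*-identityˡ δ) (ℚ.*-identityˡ δ)))
                (trans (sym (ℚ.*-distribʳ-+ δ 1ℚ 1ℚ)) 2δ≡ε)
      Nx , closex = cauchy x δ 0<δ
      Ny , closey = cauchy y δ 0<δ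
  in Nx ℕ.⊔ Ny , λ m n N≤m N≤n →
    subst (∣ (seq x m ℚ.+ seq y m) ℚ.- (seq x n ℚ.+ seq y n) ∣ ℚ.≤_) δ+δ≡ε
      (∣+∣-close (seq x m) (seq y m) (seq x n) (seq y n) δ δ
        (closex m n (ℕ.m⊔n≤o⇒m≤o Nx Ny N≤m) (ℕ.m⊔n≤o⇒m≤o Nx Ny N≤n))
        (closey m n (ℕ.m⊔n≤o⇒n≤o Nx Ny N≤m) (ℕ.m⊔n≤o⇒n≤o Nx Ny N≤n)))

_*_ : ℝ → ℝ → ℝ
(x * y) .seq n = seq x n ℚ.* seq y n
(x * y) .cauchy ε 0<ε =
  let Bx , Mx , 0<Bx , boundx = bounded x
      By , My , 0<By , boundy = bounded y
      δ , 0<δ , Bδ≡ε = shrink (Bx ℚ.+ By) ε (ℚ.+-mono-< {0ℚ} {Bx} {0ℚ} {By} 0<Bx 0<By) 0<ε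
      Nx , closex = cauchy x δ 0<δ
      Ny , closey = cauchy y δ 0<δ
      M = Mx ℕ.⊔ My
      N = Nx ℕ.⊔ Ny
  in M ℕ.⊔ N , λ m n K≤m K≤n →
    let M≤m = ℕ.m⊔n≤o⇒m≤o M N K≤m
        M≤n = ℕ.m⊔n≤o⇒m≤o M N K≤n
        N≤m = ℕ.m⊔n≤o⇒n≤o M N K≤m
        N≤n = ℕ.m⊔n≤o⇒n≤o M N K≤n
    in subst (∣ seq x m ℚ.* seq y m ℚ.- seq x n ℚ.* seq y n ∣ ℚ.≤_) Bδ≡ε
      (∣*∣-close (seq x m) (seq y m) (seq x n) (seq y n) Bx By δ
        (boundx m (ℕ.m⊔n≤o⇒m≤o Mx My M≤m))
        (boundy n (ℕ.m⊔n≤o⇒n≤o Mx My M≤n))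
        (ℚ.<⇒≤ 0<δ)
        (closex m n (ℕ.m⊔n≤o⇒m≤o Nx Ny N≤m) (ℕ.m⊔n≤o⇒m≤o Nx Ny N≤n))
        (closey m n (ℕ.m⊔n≤o⇒n≤o Nx Ny N≤m) (ℕ.m⊔n≤o⇒n≤o Nx Ny N≤n)))

Matrix : ℕ → Set
Matrix n = Fin n → Fin n → ℝ

_·_ : ∀ {n} → Matrix n → Vector ℝ n → Vector ℝ n
(A · v) i = foldr _+_ 0ℝ (λ j → A i j * v j)

IsEigenvalue : ∀ {n} → Matrix n → ℝ → Set
IsEigenvalue {n} A θ = ∃ λ (v : Vector ℝ n) →
  ¬ (∀ i → v i ≃ 0ℝ) × (∀ i → (A · v) i ≃ θ * v i)

-- Eigenvalues are ranked without multiplicity: exactly one eigenvalue θ₀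
-- of A is larger than θ.
IsSecondLargestEigenvalue : ∀ {n} → Matrix n → ℝ → Set
IsSecondLargestEigenvalue A θ = IsEigenvalue A θ ×
  ∃ λ θ₀ → IsEigenvalue A θ₀ × θ < θ₀ × (∀ μ → IsEigenvalue A μ → θ < μ → μ ≃ θ₀)

record Graph : Set where
  field
    order     : ℕ
    adj       : Fin order → Fin order → Bool
    symmetric : ∀ x y → adj x y ≡ adj y x
    loopless  : ∀ x → adj x x ≡ false

  Vertex : Set
  Vertex = Fin order

  adjacencyMatrix : Matrix order
  adjacencyMatrix x y = if adj x y then 1ℝ else 0ℝ

  Walk : Vertex → Vertex → ℕ → Set
  Walk x y zero    = x ≡ y
  Walk x y (suc i) = ∃ λ z → Walk x z i × T (adj z y)

  AtDistance : Vertex → Vertex → ℕ → Set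
  AtDistance x y i = Walk x y i × (∀ {j} → j ℕ.< i → ¬ Walk x y j)

  walk? : ∀ x y i → Dec (Walk x y i)
  walk? x y zero    = x Fin.≟ y
  walk? x y (suc i) = Fin.any? λ z → walk? x z i ×-dec T? (adj z y)

  atDistance? : ∀ x y i → Dec (AtDistance x y i)
  atDistance? x y i = walk? x y i ×-dec ℕ.allUpTo? (λ j → ¬? (walk? x y j)) i

  Connected : Set
  Connected = ∀ x y → ∃ λ i → Walk x y i

  HasDiameter : ℕ → Set
  HasDiameter D = (∀ x y → ∃ λ i → i ℕ.≤ D × AtDistance x y i) ×
                  (∃₂ λ x y → AtDistance x y D)

  neighboursAtDistance : (x y : Vertex) → ℕ → ℕ
  neighboursAtDistance x y j =
    length (filter (λ z → T? (adj y z) ×-dec atDistance? x z j) (allFin order))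

  -- The neighbours of y at distance i - 1 from x; none when i = 0.
  neighboursAtDistance-1 : (x y : Vertex) → ℕ → ℕ
  neighboursAtDistance-1 x y zero    = 0
  neighboursAtDistance-1 x y (suc i) = neighboursAtDistance x y i

open Graph public

infix 4 _≅_

record _≅_ (Γ Δ : Graph) : Set where
  field
    bijection     : Vertex Γ ↔ Vertex Δ
    adj-preserved : ∀ x y → adj Δ (Inverse.to bijection x) (Inverse.to bijection y) ≡ adj Γ x y

-- Finiteness of the number of isomorphism classes of graphs satisfying P.
-- The listed graphs need not themselves satisfy P.
FinitelyManyUpToIso : (Graph → Set) → Set
FinitelyManyUpToIso P = ∃ λ (Δs : List Graph) → ∀ Γ → P Γ → Any (Γ ≅_) Δs

record IsDistanceRegular (Γ : Graph) (D : ℕ) : Set where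
  field
    connected : Connected Γ
    diameter  : HasDiameter Γ D
    b c       : Fin (suc D) → ℕ
    c-count   : ∀ i x y → AtDistance Γ x y (toℕ i) →
                neighboursAtDistance-1 Γ x y (toℕ i) ≡ c i
    b-count   : ∀ i x y → AtDistance Γ x y (toℕ i) →
                neighboursAtDistance Γ x y (suc (toℕ i)) ≡ b i

  -- the valency
  k : ℕ
  k = b zero

  a : Fin (suc D) → ℤ
  a i = + k ℤ.- + b i ℤ.- + c i

record IsShilla (Γ : Graph) : Set where
  field
    isDistanceRegular : IsDistanceRegular Γ 3

  open IsDistanceRegular isDistanceRegular public

  a₁ : ℤ
  a₁ = a (suc zero)

  a₃ : ℤ
  a₃ = a (suc (suc (suc zero)))

  field
    a₃-secondLargest : IsSecondLargestEigenvalue (adjacencyMatrix Γ) (fromℤ a₃)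

  b⟨Γ⟩ : ℤ
  b⟨Γ⟩ = a₃ ℤ.- a₁

{-# OPTIONS --safe #-}

-- Put θ = a₃. That θ is an eigenvalue forces the third term of its standard
-- sequence to vanish, whence k = θ β, b₁ = (θ + 1)(β - 1), c₃ = θ (β - 1), and the
-- integer matrix W with entries β b₂, b₂, 0, -c₂ at distances 0, 1, 2, 3 satisfies
-- A W = θ W and W² = S W with S ≥ θ (b₂ + c₂).
--
-- A greedy coclique of size β + 1 in the neighbourhood of a vertex (the Koolen–Park
-- bound) gives θ + 1 ≤ T c₂ with T depending on β only, so the order n is at most K θ
-- with K depending on β only. Hence the rank of W, at most n β b₂ / S, is bounded in
-- terms of β. To avoid linear algebra, the rank enters through pairs (x, y) for which the
-- vectors W (e_x - e_y) are orthogonal: Bessel's inequality bounds the number of such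
-- pairs by K β², whereas a Ramsey-type argument finds more of them when n is large. So n
-- is bounded in terms of β.

module Submission where

import Algebra.Properties.Semiring.Sum as SemiringSum
open import Algebra.Bundles using (module CommutativeRing)
open import Data.Bool.Base using (Bool; true; false; T; _∧_; _∨_; not)
open import Data.Bool.Properties using (T?; ∧-comm; ∧-zeroʳ; ∧-identityʳ; ∧-idem; ∧-distribˡ-∨)
open import Data.Empty using (⊥-elim)
open import Data.Fin.Base using (Fin; zero; suc; toℕ; fromℕ<)
open import Data.Fin.Patterns using (0F; 1F; 2F; 3F)
import Data.Fin.Properties as Fin
open import Data.Integer.Base as ℤ
  using (ℤ; +_; -[1+_]; _+_; _*_; _-_; -_; _≤_; _<_; +≤+; +<+; -<+; 0ℤ; 1ℤ; nonNegative; positive; >-nonZero)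
import Data.Integer.Properties as ℤ
open import Data.Integer.Tactic.RingSolver using (solve-∀)
open import Data.List.Base
  using (List; []; _∷_; length; filter; map; tabulate; allFin; concatMap; cartesianProductWith; upTo)
open import Data.List.Membership.Propositional using (_∈_; lose)
open import Data.List.Membership.Propositional.Properties using (∈-filter⁻; ∈-upTo⁺)
import Data.List.Properties as List
open import Data.List.Relation.Unary.All as All using (All; []; _∷_)
import Data.List.Relation.Unary.All.Properties as All
open import Data.List.Relation.Unary.AllPairs as AllPairs using (AllPairs; []; _∷_)
import Data.List.Relation.Unary.AllPairs.Properties as AllPairs
open import Data.List.Relation.Unary.Any as Any using (Any; here; there)
import Data.List.Relation.Unary.Any.Properties as Any
open import Data.List.Relation.Unary.Unique.Propositional using (Unique)
import Data.List.Relation.Unary.Unique.Propositional.Properties as Unique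
import Data.Nat.Coprimality as Coprimality
open import Data.Nat.Base as ℕ using (ℕ; zero; suc; z≤n; s≤s)
import Data.Nat.Properties as ℕ
open import Data.Product.Base using (Σ; ∃; ∃-syntax; _×_; _,_; proj₁; proj₂)
open import Data.Rational.Base as ℚ using (ℚ; mkℚ; 0ℚ; 1ℚ; ∣_∣)
import Data.Rational.Properties as ℚ
open import Data.Sum.Base using (_⊎_; inj₁; inj₂)
open import Data.Unit.Base using (tt)
open import Data.Vec.Functional as Vector using (Vector; foldr)
open import Function.Base using (_∘_; id)
open import Function.Bundles using (mk⇔)
open import Function.Construct.Identity using (↔-id)
open import Relation.Binary.PropositionalEquality
open import Relation.Nullary.Decidable
  using (does; yes; no; _×-dec_; ¬?; does-⇔; dec-true; dec-false; decidable-stable)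
open import Relation.Nullary.Negation using (¬_; contradiction)
open import Relation.Unary using (Pred; Decidable)

open import Defs using (FinitelyManyUpToIso; IsShilla)
open import Defs
  using (ℝ; seq; 0ℝ; fromℤ; _≃_; Matrix; _·_; IsEigenvalue; shrink; ∣*∣-mono-≤; ∣+∣-mono-≤;
         Graph; _≅_; IsDistanceRegular)
open SemiringSum ℤ.+-*-semiring
  using (sum; sum-syntax; sum-cong-≗; ∑-distrib-+; ∑-comm; *-distribˡ-sum; *-distribʳ-sum; sum-replicate-zero)

-- Real numbers matter at a single point: they show that one integer, the `defect` of W, is zero.
-- Everything later is integer arithmetic. W is symmetric, so W² = S W makes it, up to the factor S,
-- the Gram matrix of its own rows. Inner products of the vectors W (e_x - e_y) are thus read off
-- from distances, and orthogonality follows from an equality of colours when pairs of vertices are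
-- coloured by their distance. The obstacle is the size of θ. A priori the second sphere has k b₁ /
-- c₂ vertices, quadratic in θ, while division by S gains only one factor θ. The lower bound for c₂,
-- linear in θ, makes the order linear in θ as well, and the two factors cancel. Bessel's inequality
-- is applied to each row W z and summed over z. This replaces the trace: the rows all have norm S β
-- b₂, and together they recover S² times the norm of each difference.

-- Sums of integers

-- The form in which nonlinear inequalities are proved below: the difference of the two sides is
-- written as a visibly nonnegative expression `d`, and the ring solver checks the identity.
≤-from-difference : ∀ {i j} d → 0ℤ ≤ d → j - i ≡ d → i ≤ j
≤-from-difference d 0≤d eq = ℤ.0≤i-j⇒j≤i (subst (0ℤ ≤_) (sym eq) 0≤d)

0≤i*j : ∀ {i j} → 0ℤ ≤ i → 0ℤ ≤ j → 0ℤ ≤ i * j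
0≤i*j {i} {j} 0≤i 0≤j =
  subst (_≤ i * j) (ℤ.*-zeroʳ i) (ℤ.*-monoˡ-≤-nonNeg i {{nonNegative 0≤i}} 0≤j)

0≤i+j : ∀ {i j} → 0ℤ ≤ i → 0ℤ ≤ j → 0ℤ ≤ i + j
0≤i+j = ℤ.+-mono-≤

0≤i*i : ∀ i → 0ℤ ≤ i * i
0≤i*i (+ n)    = 0≤i*j {+ n} {+ n} (+≤+ z≤n) (+≤+ z≤n)
0≤i*i -[1+ n ] = +≤+ z≤n

*-monoˡ-≤ : ∀ {i j k} → 0ℤ ≤ k → i ≤ j → k * i ≤ k * j
*-monoˡ-≤ {k = k} 0≤k = ℤ.*-monoˡ-≤-nonNeg k {{nonNegative 0≤k}}

*-cancelˡ-≤ : ∀ {i j k} → 0ℤ < k → k * i ≤ k * j → i ≤ j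
*-cancelˡ-≤ {i} {j} {k} 0<k = ℤ.*-cancelˡ-≤-pos i j k {{positive 0<k}}

*-cancelˡ-≡ : ∀ {i j k} → 0ℤ < k → k * i ≡ k * j → i ≡ j
*-cancelˡ-≡ {i} {j} {k} 0<k = ℤ.*-cancelˡ-≡ k i j {{>-nonZero 0<k}}

sum-mono-≤ : ∀ {n} {f g : Vector ℤ n} → (∀ i → f i ≤ g i) → sum f ≤ sum g
sum-mono-≤ {zero}  f≤g = ℤ.≤-refl
sum-mono-≤ {suc n} f≤g = ℤ.+-mono-≤ (f≤g zero) (sum-mono-≤ (f≤g ∘ suc))

sum-0 : ∀ {n} {f : Vector ℤ n} → (∀ i → f i ≡ 0ℤ) → sum f ≡ 0ℤ
sum-0 {n} f≡0 = trans (sum-cong-≗ f≡0) (sum-replicate-zero n)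

sum-nonNeg : ∀ {n} {f : Vector ℤ n} → (∀ i → 0ℤ ≤ f i) → 0ℤ ≤ sum f
sum-nonNeg {n} {f} 0≤f = subst (_≤ sum f) (sum-replicate-zero n) (sum-mono-≤ 0≤f)

term≤sum : ∀ {n} {f : Vector ℤ n} → (∀ i → 0ℤ ≤ f i) → ∀ i → f i ≤ sum f
term≤sum {f = f} 0≤f zero    =
  subst (_≤ sum f) (ℤ.+-identityʳ (f zero)) (ℤ.+-monoʳ-≤ (f zero) (sum-nonNeg (0≤f ∘ suc)))
term≤sum {f = f} 0≤f (suc i) =
  ℤ.≤-trans (term≤sum (0≤f ∘ suc) i)
    (subst (_≤ sum f) (ℤ.+-identityˡ _) (ℤ.+-monoˡ-≤ _ (0≤f zero)))

sum-const : ∀ n i → sum {n} (λ _ → i) ≡ + n * i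
sum-const zero    i = sym (ℤ.*-zeroˡ i)
sum-const (suc n) i = trans (cong (λ s → i + s) (sum-const n i)) (sym (ℤ.suc-* (+ n) i))

∑-distrib-- : ∀ {n} (f g : Vector ℤ n) → ∑[ i < n ] (f i - g i) ≡ sum f - sum g
∑-distrib-- {n} f g = begin
  ∑[ i < n ] (f i - g i)                ≡⟨ sum-cong-≗ (λ i → eq (f i) (g i)) ⟩
  ∑[ i < n ] (f i + - 1ℤ * g i)         ≡⟨ ∑-distrib-+ f _ ⟩
  sum f + ∑[ i < n ] (- 1ℤ * g i)       ≡⟨ cong (λ s → sum f + s) (*-distribˡ-sum (- 1ℤ) g) ⟨
  sum f + - 1ℤ * sum g                  ≡⟨ eq (sum f) (sum g) ⟨
  sum f - sum g                         ∎
  where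
  open ≡-Reasoning
  eq : ∀ i j → i - j ≡ i + - 1ℤ * j
  eq = solve-∀

-- Iverson bracket: cardinalities become integer sums, and double counting becomes `∑-comm`.
⟦_⟧ : Bool → ℤ
⟦ true  ⟧ = 1ℤ
⟦ false ⟧ = 0ℤ

⟦⟧-nonNeg : ∀ b → 0ℤ ≤ ⟦ b ⟧
⟦⟧-nonNeg true  = +≤+ z≤n
⟦⟧-nonNeg false = +≤+ z≤n

⟦⟧-∧ : ∀ b c → ⟦ b ∧ c ⟧ ≡ ⟦ b ⟧ * ⟦ c ⟧
⟦⟧-∧ true  c = sym (ℤ.*-identityˡ ⟦ c ⟧)
⟦⟧-∧ false c = refl

length-filter-tabulate : ∀ {n p} {A : Set} {P : Pred A p} (P? : Decidable P) (f : Fin n → A) →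
                         + length (filter P? (tabulate f)) ≡ ∑[ i < n ] ⟦ does (P? (f i)) ⟧
length-filter-tabulate {zero}  P? f = refl
length-filter-tabulate {suc n} P? f with does (P? (f zero))
... | true  = cong (λ s → 1ℤ + s) (length-filter-tabulate P? (f ∘ suc))
... | false = trans (length-filter-tabulate P? (f ∘ suc)) (sym (ℤ.+-identityˡ _))

sum-≟ : ∀ {n} (f : Vector ℤ n) i → ∑[ j < n ] (⟦ does (i Fin.≟ j) ⟧ * f j) ≡ f i
sum-≟ {suc n} f zero = begin
  1ℤ * f zero + ∑[ j < n ] (0ℤ * f (suc j))  ≡⟨ cong₂ _+_ (ℤ.*-identityˡ (f zero)) (sum-0 {n} (λ _ → refl)) ⟩
  f zero + 0ℤ                               ≡⟨ ℤ.+-identityʳ (f zero) ⟩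
  f zero                                    ∎
  where open ≡-Reasoning
sum-≟ {suc n} f (suc i) = trans (ℤ.+-identityˡ _) (sum-≟ (f ∘ suc) i)

infix 8 _∙_
_∙_ : ∀ {n} → Vector ℤ n → Vector ℤ n → ℤ
_∙_ {n} f g = ∑[ i < n ] (f i * g i)

-- Distances in a distance-regular graph

e : ℕ → ℕ → ℤ
e j d = ⟦ does (d ℕ.≟ j) ⟧

e-≡ : ∀ {j d} → d ≡ j → e j d ≡ 1ℤ
e-≡ {j} {d} d≡j = cong ⟦_⟧ (dec-true (d ℕ.≟ j) d≡j)

e-≢ : ∀ {j d} → ¬ d ≡ j → e j d ≡ 0ℤ
e-≢ {j} {d} d≢j = cong ⟦_⟧ (dec-false (d ℕ.≟ j) d≢j)

module Distance (Γ : Graph) (isDR : IsDistanceRegular Γ 3) where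
  open Graph Γ
  open IsDistanceRegular isDR

  walk-cons : ∀ {x y z i} → T (adj x y) → Walk y z i → Walk x z (suc i)
  walk-cons {x} {i = zero}  xy refl         = x , refl , xy
  walk-cons     {i = suc i} xy (u , yu , uz) = u , walk-cons xy yu , uz

  walk-sym : ∀ {x y i} → Walk x y i → Walk y x i
  walk-sym {i = zero}  refl = refl
  walk-sym {y = y} {i = suc i} (z , xz , zy) =
    walk-cons (subst T (symmetric z y) zy) (walk-sym xz)

  atDistance-sym : ∀ {x y i} → AtDistance x y i → AtDistance y x i
  atDistance-sym (xy , min) = walk-sym xy , λ j<i yx → min j<i (walk-sym yx)

  atDistance-min : ∀ {x y i j} → AtDistance x y i → Walk x y j → i ℕ.≤ j
  atDistance-min (_ , min) xy = ℕ.≮⇒≥ (λ j<i → min j<i xy)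

  atDistance-unique : ∀ {x y i j} → AtDistance x y i → AtDistance x y j → i ≡ j
  atDistance-unique p q =
    ℕ.≤-antisym (atDistance-min p (proj₁ q)) (atDistance-min q (proj₁ p))

  atDistance-pred : ∀ {x y i} → AtDistance x y (suc i) → ∃ λ z → AtDistance x z i × T (adj z y)
  atDistance-pred ((z , xz , zy) , min) =
    z , (xz , λ j<i walk → min (s≤s j<i) (z , walk , zy)) , zy

  -- Kept in `Fin 4` in order to index `b`, `c` and `a`, and to serve as a colour with four values
  -- later on.
  dist : Vertex → Vertex → Fin 4
  dist x y = fromℕ< (s≤s (proj₁ (proj₂ (proj₁ diameter x y))))

  d : Vertex → Vertex → ℕ
  d x y = toℕ (dist x y)

  d-atDistance : ∀ x y → AtDistance x y (d x y)
  d-atDistance x y =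
    subst (AtDistance x y) (sym (Fin.toℕ-fromℕ< _)) (proj₂ (proj₂ (proj₁ diameter x y)))

  d-unique : ∀ {x y i} → AtDistance x y i → d x y ≡ i
  d-unique {x} {y} = atDistance-unique (d-atDistance x y)

  d-refl : ∀ x → d x x ≡ 0
  d-refl x = d-unique (refl , λ ())

  d≡0⇒≡ : ∀ {x y} → d x y ≡ 0 → x ≡ y
  d≡0⇒≡ {x} {y} d≡0 = proj₁ (subst (AtDistance x y) d≡0 (d-atDistance x y))

  d-sym : ∀ x y → d x y ≡ d y x
  d-sym x y = d-unique (atDistance-sym (d-atDistance y x))

  adj⇒d≤ : ∀ {x y z} → T (adj y z) → d x z ℕ.≤ suc (d x y)
  adj⇒d≤ {x} {y} {z} yz =
    atDistance-min (d-atDistance x z) (y , proj₁ (d-atDistance x y) , yz)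

  adj-sym : ∀ {x y} → T (adj x y) → T (adj y x)
  adj-sym {x} {y} = subst T (symmetric x y)

  adj⇒≢ : ∀ {x y} → T (adj x y) → ¬ x ≡ y
  adj⇒≢ {x} xx refl = subst T (loopless x) xx

  adj⇒d≡1 : ∀ {x y} → T (adj x y) → d x y ≡ 1
  adj⇒d≡1 {x} {y} xy with d x y in eq | adj⇒d≤ {x} xy
  ... | 0 | _ = contradiction (d≡0⇒≡ eq) (adj⇒≢ xy)
  ... | 1 | _ = refl
  ... | suc (suc i) | le with subst (λ m → suc (suc i) ℕ.≤ suc m) (d-refl x) le
  ... | s≤s ()

  d≡1⇒adj : ∀ {x y} → d x y ≡ 1 → T (adj x y)
  d≡1⇒adj {x} {y} d≡1 with proj₁ (subst (AtDistance x y) d≡1 (d-atDistance x y))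
  ... | _ , refl , xy = xy

  A : Vertex → Vertex → ℤ
  A x y = ⟦ adj x y ⟧

  A-sym : ∀ x y → A x y ≡ A y x
  A-sym x y = cong ⟦_⟧ (symmetric x y)

  A≡e₁ : ∀ x y → A x y ≡ e 1 (d x y)
  A≡e₁ x y with adj x y in eq
  ... | true  = sym (e-≡ (adj⇒d≡1 (subst T (sym eq) tt)))
  ... | false = sym (e-≢ (λ d≡1 → subst T eq (d≡1⇒adj d≡1)))

  neighbours-count : ∀ x y j → + neighboursAtDistance x y j ≡ ∑[ z < order ] (A y z * e j (d x z))
  neighbours-count x y j = trans (length-filter-tabulate (λ z → T? (adj y z) ×-dec atDistance? x z j) id)
    (sum-cong-≗ λ z → trans (⟦⟧-∧ (adj y z) _) (cong (λ b → A y z * ⟦ b ⟧)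
      (does-⇔ (mk⇔ d-unique (λ d≡j → subst (AtDistance x z) d≡j (d-atDistance x z)))
        (atDistance? x z j) (d x z ℕ.≟ j))))

  count-b : ∀ x y → ∑[ z < order ] (A y z * e (suc (d x y)) (d x z)) ≡ + b (dist x y)
  count-b x y = trans (sym (neighbours-count x y _)) (cong +_ (b-count (dist x y) x y (d-atDistance x y)))

  count-c : ∀ {x y i} → d x y ≡ suc i → ∑[ z < order ] (A y z * e i (d x z)) ≡ + c (dist x y)
  count-c {x} {y} {i} eq = trans (sym (neighbours-count x y _))
    (cong +_ (trans (cong (neighboursAtDistance-1 x y) (sym eq)) (c-count (dist x y) x y (d-atDistance x y))))

  ∑A≡k : ∀ y → ∑[ z < order ] A y z ≡ + k
  ∑A≡k y = trans (sum-cong-≗ pointwise) (trans (count-b y y) (cong (λ i → + b i) (Fin.toℕ-injective (d-refl y))))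
    where
    pointwise : ∀ z → A y z ≡ A y z * e (suc (d y y)) (d y z)
    pointwise z rewrite d-refl y | A≡e₁ y z with does (d y z ℕ.≟ 1)
    ... | true  = refl
    ... | false = refl

  c₀≡0 : Vertex → c 0F ≡ 0
  c₀≡0 x = sym (c-count 0F x x (refl , λ ()))

  -- L φ ∘ dist x is the image under A of φ ∘ d x.
  L : (ℕ → ℤ) → Fin 4 → ℤ
  L φ i = + c i * φ (ℕ.pred (toℕ i)) + a i * φ (toℕ i) + + b i * φ (suc (toℕ i))

  -- With i = d x y, a neighbour of y lies at distance i - 1, i or i + 1 from x, and these classes
  -- have c i, a i and b i members. The out-of-range values cause no harm: at i = 0 the term φ (pred
  -- 0) has coefficient c 0 = 0, and φ 4 has coefficient b 3 = 0.
  three-term : ∀ (φ : ℕ → ℤ) x y → ∑[ z < order ] (A y z * φ (d x z)) ≡ L φ (dist x y)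
  three-term φ x y with dist x y in eq
  ... | 0F rewrite c₀≡0 x = begin
    ∑[ z < order ] (A y z * φ (d x z))
      ≡⟨ sum-cong-≗ pointwise ⟩
    ∑[ z < order ] (φ 1 * A y z)
      ≡⟨ *-distribˡ-sum (φ 1) (A y) ⟨
    φ 1 * ∑[ z < order ] A y z
      ≡⟨ cong (φ 1 *_) (∑A≡k y) ⟩
    φ 1 * + k
      ≡⟨ ring (+ k) (φ 0) (φ 1) ⟩
    0ℤ * φ 0 + (+ k - + k - 0ℤ) * φ 0 + + k * φ 1 ∎
    where
    open ≡-Reasoning
    ring : ∀ k p q → q * k ≡ 0ℤ * p + (k - k - 0ℤ) * p + k * q
    ring = solve-∀
    x≡y : x ≡ y
    x≡y = d≡0⇒≡ (cong toℕ eq)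
    pointwise : ∀ z → A y z * φ (d x z) ≡ φ 1 * A y z
    pointwise z with adj y z in yz
    ... | false = sym (ℤ.*-zeroʳ (φ 1))
    ... | true  = trans (cong (λ m → 1ℤ * φ m)
                    (trans (cong (λ v → d v z) x≡y) (adj⇒d≡1 (subst T (sym yz) tt))))
                    (ℤ.*-comm 1ℤ (φ 1))
  ... | i@(suc p′) = begin
    ∑[ z < order ] (A y z * φ (d x z))
      ≡⟨ sum-cong-≗ pointwise ⟩
    -- The middle class is counted as what the other two leave of the neighbourhood of y, in
    -- accordance with a = k - b - c.
    ∑[ z < order ] (φ p * E₀ z + φ (1 ℕ.+ p) * (A y z - E₀ z - E₂ z) + φ (2 ℕ.+ p) * E₂ z)
      ≡⟨ trans (∑-distrib-+ _ (λ z → φ (2 ℕ.+ p) * E₂ z))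
           (cong₂ _+_ (∑-distrib-+ (λ z → φ p * E₀ z) _) (sym (*-distribˡ-sum (φ (2 ℕ.+ p)) E₂))) ⟩
    ∑[ z < order ] (φ p * E₀ z) + ∑[ z < order ] (φ (1 ℕ.+ p) * (A y z - E₀ z - E₂ z))
      + φ (2 ℕ.+ p) * sum E₂
      ≡⟨ cong (λ s → s + φ (2 ℕ.+ p) * sum E₂) (cong₂ _+_ (sym (*-distribˡ-sum (φ p) E₀))
           (trans (sym (*-distribˡ-sum (φ (1 ℕ.+ p)) (λ z → A y z - E₀ z - E₂ z)))
             (cong (φ (1 ℕ.+ p) *_) (trans (∑-distrib-- (λ z → A y z - E₀ z) E₂) (cong (_- sum E₂) (∑-distrib-- (A y) E₀)))))) ⟩
    φ p * sum E₀ + φ (1 ℕ.+ p) * (sum (A y) - sum E₀ - sum E₂) + φ (2 ℕ.+ p) * sum E₂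
      ≡⟨ cong₃ (λ s t u → φ p * s + φ (1 ℕ.+ p) * (t - s - u) + φ (2 ℕ.+ p) * u)
           (trans (count-c (cong toℕ eq)) (cong (λ j → + c j) eq)) (∑A≡k y)
           (trans (cong (λ m → ∑[ z < order ] (A y z * e (suc m) (d x z))) (sym (cong toℕ eq)))
             (trans (count-b x y) (cong (λ j → + b j) eq))) ⟩
    φ p * + c i + φ (1 ℕ.+ p) * (+ k - + c i - + b i) + φ (2 ℕ.+ p) * + b i
      ≡⟨ ring (+ k) (+ b i) (+ c i) (φ p) (φ (1 ℕ.+ p)) (φ (2 ℕ.+ p)) ⟩
    + c i * φ p + (+ k - + b i - + c i) * φ (1 ℕ.+ p) + + b i * φ (2 ℕ.+ p) ∎
    where
    open ≡-Reasoning
    p = toℕ p′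
    E₀ E₂ : Vector ℤ order
    E₀ z = A y z * e p (d x z)
    E₂ z = A y z * e (2 ℕ.+ p) (d x z)
    cong₃ : ∀ (f : ℤ → ℤ → ℤ → ℤ) {s s′ t t′ u u′} → s ≡ s′ → t ≡ t′ → u ≡ u′ → f s t u ≡ f s′ t′ u′
    cong₃ f refl refl refl = refl
    ring : ∀ k b c p q r → p * c + q * (k - c - b) + r * b ≡ c * p + (k - b - c) * q + b * r
    ring = solve-∀
    off : ∀ p q r → 0ℤ ≡ p * 0ℤ + q * (0ℤ - 0ℤ - 0ℤ) + r * 0ℤ
    off = solve-∀
    on₀ : ∀ p q r → 1ℤ * p ≡ p * (1ℤ * 1ℤ) + q * (1ℤ - 1ℤ * 1ℤ - 1ℤ * 0ℤ) + r * (1ℤ * 0ℤ)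
    on₀ = solve-∀
    on₁ : ∀ p q r → 1ℤ * q ≡ p * (1ℤ * 0ℤ) + q * (1ℤ - 1ℤ * 0ℤ - 1ℤ * 0ℤ) + r * (1ℤ * 0ℤ)
    on₁ = solve-∀
    on₂ : ∀ p q r → 1ℤ * r ≡ p * (1ℤ * 0ℤ) + q * (1ℤ - 1ℤ * 0ℤ - 1ℤ * 1ℤ) + r * (1ℤ * 1ℤ)
    on₂ = solve-∀
    near : ∀ m → p ℕ.≤ m → m ℕ.≤ 2 ℕ.+ p → m ≡ p ⊎ m ≡ 1 ℕ.+ p ⊎ m ≡ 2 ℕ.+ p
    near m p≤m m≤2+p with ℕ.m≤n⇒m<n∨m≡n p≤m
    ... | inj₂ p≡m = inj₁ (sym p≡m)
    ... | inj₁ p<m with ℕ.m≤n⇒m<n∨m≡n p<m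
    ...   | inj₂ eq  = inj₂ (inj₁ (sym eq))
    ...   | inj₁ lt = inj₂ (inj₂ (ℕ.≤-antisym m≤2+p lt))
    split : ∀ m → m ≡ p ⊎ m ≡ 1 ℕ.+ p ⊎ m ≡ 2 ℕ.+ p →
            1ℤ * φ m ≡ φ p * (1ℤ * e p m) + φ (1 ℕ.+ p) * (1ℤ - 1ℤ * e p m - 1ℤ * e (2 ℕ.+ p) m)
                       + φ (2 ℕ.+ p) * (1ℤ * e (2 ℕ.+ p) m)
    split m (inj₁ refl)
      rewrite e-≡ {p} {p} refl | e-≢ {2 ℕ.+ p} {p} (λ eq → ℕ.m≢1+n+m p {1} eq)
      = on₀ (φ p) (φ (1 ℕ.+ p)) (φ (2 ℕ.+ p))
    split m (inj₂ (inj₁ refl))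
      rewrite e-≢ {p} {1 ℕ.+ p} (λ eq → ℕ.m≢1+n+m p {0} (sym eq))
            | e-≢ {2 ℕ.+ p} {1 ℕ.+ p} (λ eq → ℕ.m≢1+n+m p {0} (ℕ.suc-injective eq))
      = on₁ (φ p) (φ (1 ℕ.+ p)) (φ (2 ℕ.+ p))
    split m (inj₂ (inj₂ refl))
      rewrite e-≢ {p} {2 ℕ.+ p} (λ eq → ℕ.m≢1+n+m p {1} (sym eq)) | e-≡ {2 ℕ.+ p} {2 ℕ.+ p} refl
      = on₂ (φ p) (φ (1 ℕ.+ p)) (φ (2 ℕ.+ p))
    pointwise : ∀ z → A y z * φ (d x z) ≡
                φ p * E₀ z + φ (1 ℕ.+ p) * (A y z - E₀ z - E₂ z) + φ (2 ℕ.+ p) * E₂ z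
    pointwise z with adj y z in yz
    ... | false = off (φ p) (φ (1 ℕ.+ p)) (φ (2 ℕ.+ p))
    ... | true  = split (d x z) (near (d x z)
                    (ℕ.s≤s⁻¹ (subst (ℕ._≤ suc (d x z)) (cong toℕ eq) (adj⇒d≤ (adj-sym T-yz))))
                    (subst (λ m → d x z ℕ.≤ suc m) (cong toℕ eq) (adj⇒d≤ T-yz)))
      where
      T-yz : T (adj y z)
      T-yz = subst T (sym yz) tt

-- Eigenfunctions and sums over spheres

module Spectrum (Γ : Graph) (isDR : IsDistanceRegular Γ 3) where
  open Graph Γ
  open IsDistanceRegular isDR
  open Distance Γ isDR public

  IsEigenfunction : (Vertex → ℤ) → ℤ → Set
  IsEigenfunction g μ = ∀ y → ∑[ z < order ] (A y z * g z) ≡ μ * g y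

  constant-isEigenfunction : IsEigenfunction (λ _ → 1ℤ) (+ k)
  constant-isEigenfunction y = begin
    ∑[ z < order ] (A y z * 1ℤ)  ≡⟨ sum-cong-≗ (λ z → ℤ.*-identityʳ (A y z)) ⟩
    ∑[ z < order ] A y z         ≡⟨ ∑A≡k y ⟩
    + k                          ≡⟨ ℤ.*-identityʳ (+ k) ⟨
    + k * 1ℤ                     ∎
    where open ≡-Reasoning

  infix 8 _⋆_
  _⋆_ : (ℕ → ℤ) → (Vertex → ℤ) → Vertex → ℤ
  (φ ⋆ g) x = ∑[ z < order ] (φ (d x z) * g z)

  -- By symmetry of A, applying A to the radial function φ ∘ d x has the same effect on the sum as
  -- applying it to g.
  L-adjoint : ∀ g μ → IsEigenfunction g μ → ∀ φ x →
              ∑[ z < order ] (L φ (dist x z) * g z) ≡ μ * (φ ⋆ g) x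
  L-adjoint g μ eigen φ x = begin
    ∑[ z < order ] (L φ (dist x z) * g z)
      ≡⟨ sum-cong-≗ (λ z → trans (cong (_* g z) (sym (three-term φ x z)))
           (*-distribʳ-sum (g z) (λ u → A z u * φ (d x u)))) ⟩
    ∑[ z < order ] ∑[ u < order ] (A z u * φ (d x u) * g z)
      ≡⟨ ∑-comm (λ z u → A z u * φ (d x u) * g z) ⟩
    ∑[ u < order ] ∑[ z < order ] (A z u * φ (d x u) * g z)
      ≡⟨ sum-cong-≗ inner ⟩
    ∑[ u < order ] (μ * (φ (d x u) * g u))
      ≡⟨ *-distribˡ-sum μ (λ u → φ (d x u) * g u) ⟨
    μ * (φ ⋆ g) x ∎
    where
    open ≡-Reasoning
    swap : ∀ p q r → p * q * r ≡ q * (p * r)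
    swap = solve-∀
    swap′ : ∀ p q r → p * (q * r) ≡ q * (p * r)
    swap′ = solve-∀
    inner : ∀ u → ∑[ z < order ] (A z u * φ (d x u) * g z) ≡ μ * (φ (d x u) * g u)
    inner u = begin
      ∑[ z < order ] (A z u * φ (d x u) * g z)
        ≡⟨ sum-cong-≗ (λ z → trans (cong (λ s → s * φ (d x u) * g z) (A-sym z u)) (swap (A u z) (φ (d x u)) (g z))) ⟩
      ∑[ z < order ] (φ (d x u) * (A u z * g z))
        ≡⟨ *-distribˡ-sum (φ (d x u)) (λ z → A u z * g z) ⟨
      φ (d x u) * ∑[ z < order ] (A u z * g z)
        ≡⟨ cong (φ (d x u) *_) (eigen u) ⟩
      φ (d x u) * (μ * g u)
        ≡⟨ swap′ (φ (d x u)) μ (g u) ⟩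
      μ * (φ (d x u) * g u) ∎

  -- The j-th distance matrix applied to g, that is, the sum of g over the sphere of radius j.
  F : ℕ → (Vertex → ℤ) → Vertex → ℤ
  F j g = e j ⋆ g

  radial-sum : ∀ (ψ : Fin 4 → ℤ) g x → ∑[ z < order ] (ψ (dist x z) * g z) ≡
               ψ 0F * F 0 g x + ψ 1F * F 1 g x + ψ 2F * F 2 g x + ψ 3F * F 3 g x
  radial-sum ψ g x = begin
    ∑[ z < order ] (ψ (dist x z) * g z)
      ≡⟨ sum-cong-≗ (λ z → pointwise (dist x z) (g z)) ⟩
    ∑[ z < order ] (t 0F z + t 1F z + t 2F z + t 3F z)
      ≡⟨ trans (∑-distrib-+ (λ z → t 0F z + t 1F z + t 2F z) (t 3F)) (cong (_+ sum (t 3F))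
           (trans (∑-distrib-+ (λ z → t 0F z + t 1F z) (t 2F)) (cong (_+ sum (t 2F))
             (∑-distrib-+ (t 0F) (t 1F))))) ⟩
    sum (t 0F) + sum (t 1F) + sum (t 2F) + sum (t 3F)
      ≡⟨ cong₂ _+_ (cong₂ _+_ (cong₂ _+_ (factor 0F) (factor 1F)) (factor 2F)) (factor 3F) ⟩
    ψ 0F * F 0 g x + ψ 1F * F 1 g x + ψ 2F * F 2 g x + ψ 3F * F 3 g x ∎
    where
    open ≡-Reasoning
    t : Fin 4 → Vertex → ℤ
    t i z = ψ i * (e (toℕ i) (d x z) * g z)
    factor : ∀ i → sum (t i) ≡ ψ i * F (toℕ i) g x
    factor i = sym (*-distribˡ-sum (ψ i) (λ z → e (toℕ i) (d x z) * g z))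
    p₀ : ∀ a b c d g → a * g ≡ a * (1ℤ * g) + b * (0ℤ * g) + c * (0ℤ * g) + d * (0ℤ * g)
    p₀ = solve-∀
    p₁ : ∀ a b c d g → b * g ≡ a * (0ℤ * g) + b * (1ℤ * g) + c * (0ℤ * g) + d * (0ℤ * g)
    p₁ = solve-∀
    p₂ : ∀ a b c d g → c * g ≡ a * (0ℤ * g) + b * (0ℤ * g) + c * (1ℤ * g) + d * (0ℤ * g)
    p₂ = solve-∀
    p₃ : ∀ a b c d g → d * g ≡ a * (0ℤ * g) + b * (0ℤ * g) + c * (0ℤ * g) + d * (1ℤ * g)
    p₃ = solve-∀
    pointwise : ∀ i h → ψ i * h ≡ ψ 0F * (e 0 (toℕ i) * h) + ψ 1F * (e 1 (toℕ i) * h)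
                                  + ψ 2F * (e 2 (toℕ i) * h) + ψ 3F * (e 3 (toℕ i) * h)
    pointwise 0F = p₀ (ψ 0F) (ψ 1F) (ψ 2F) (ψ 3F)
    pointwise 1F = p₁ (ψ 0F) (ψ 1F) (ψ 2F) (ψ 3F)
    pointwise 2F = p₂ (ψ 0F) (ψ 1F) (ψ 2F) (ψ 3F)
    pointwise 3F = p₃ (ψ 0F) (ψ 1F) (ψ 2F) (ψ 3F)

  F₀ : ∀ g x → F 0 g x ≡ g x
  F₀ g x = trans (sum-cong-≗ (λ z → cong (λ b → ⟦ b ⟧ * g z)
    (does-⇔ (mk⇔ d≡0⇒≡ (λ { refl → d-refl x })) (d x z ℕ.≟ 0) (x Fin.≟ z)))) (sum-≟ g x)

  -- The recurrence of the distance matrices on an eigenfunction, b (j - 1) F (j - 1) + a j F j + c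
  -- (j + 1) F (j + 1) = μ F j, with its vanishing terms still written out.
  F-recurrence : ∀ g μ → IsEigenfunction g μ → ∀ j x →
                 let φ = e j in
                 L φ 0F * F 0 g x + L φ 1F * F 1 g x + L φ 2F * F 2 g x + L φ 3F * F 3 g x ≡ μ * F j g x
  F-recurrence g μ eigen j x = trans (sym (radial-sum (L (e j)) g x)) (L-adjoint g μ eigen (e j) x)

  -- A geodesic of length 3. It witnesses that every distance occurs, so that each intersection
  -- number is an actual count and positivity can be read off.
  x₀ y₃ y₂ y₁ : Vertex
  x₀ = proj₁ (proj₂ diameter)
  y₃ = proj₁ (proj₂ (proj₂ diameter))
  x₀y₃ : AtDistance x₀ y₃ 3
  x₀y₃ = proj₂ (proj₂ (proj₂ diameter))
  y₂ = proj₁ (atDistance-pred x₀y₃)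
  x₀y₂ : AtDistance x₀ y₂ 2
  x₀y₂ = proj₁ (proj₂ (atDistance-pred x₀y₃))
  y₂y₃ : T (adj y₂ y₃)
  y₂y₃ = proj₂ (proj₂ (atDistance-pred x₀y₃))
  y₁ = proj₁ (atDistance-pred x₀y₂)
  x₀y₁ : AtDistance x₀ y₁ 1
  x₀y₁ = proj₁ (proj₂ (atDistance-pred x₀y₂))
  y₁y₂ : T (adj y₁ y₂)
  y₁y₂ = proj₂ (proj₂ (atDistance-pred x₀y₂))
  x₀~y₁ : T (adj x₀ y₁)
  x₀~y₁ = d≡1⇒adj (d-unique x₀y₁)

  T⇒⟦⟧≡1 : ∀ {b} → T b → ⟦ b ⟧ ≡ 1ℤ
  T⇒⟦⟧≡1 {true} _ = refl

  count-positive : ∀ {x y z j} → T (adj y z) → AtDistance x z j →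
                   1ℤ ≤ ∑[ z < order ] (A y z * e j (d x z))
  count-positive {x} {y} {z} {j} yz xz =
    subst (_≤ ∑[ z < order ] (A y z * e j (d x z)))
      (cong₂ _*_ (T⇒⟦⟧≡1 yz) (e-≡ (d-unique xz)))
      (term≤sum (λ z → 0≤i*j (⟦⟧-nonNeg (adj y z)) (⟦⟧-nonNeg (does (d x z ℕ.≟ j)))) z)

  dist-unique : ∀ {x y} i → AtDistance x y (toℕ i) → dist x y ≡ i
  dist-unique i xy = Fin.toℕ-injective (d-unique xy)

  c-positive : ∀ {x y z i} j → AtDistance x y (toℕ j) → toℕ j ≡ suc i → AtDistance x z i → T (adj y z) → 1ℤ ≤ + c j
  c-positive {x} {y} j xy j≡ xz yz =
    subst (1ℤ ≤_) (trans (count-c (trans (d-unique xy) j≡)) (cong (λ i → + c i) (dist-unique j xy)))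
      (count-positive yz xz)

  b-positive : ∀ {x y z} j → AtDistance x y (toℕ j) → AtDistance x z (suc (toℕ j)) → T (adj y z) → 1ℤ ≤ + b j
  b-positive {x} {y} j xy xz yz =
    subst (1ℤ ≤_) (trans (cong (λ m → ∑[ z < order ] (A y z * e (suc m) (d x z))) (sym (d-unique xy)))
                    (trans (count-b x y) (cong (λ i → + b i) (dist-unique j xy))))
      (count-positive yz xz)

  1≤k : 1ℤ ≤ + k
  1≤k = b-positive 0F (refl , λ ()) x₀y₁ x₀~y₁

  1≤c₂ : 1ℤ ≤ + c 2F
  1≤c₂ = c-positive 2F x₀y₂ refl x₀y₁ (adj-sym y₁y₂)

  1≤c₃ : 1ℤ ≤ + c 3F
  1≤c₃ = c-positive 3F x₀y₃ refl x₀y₂ (adj-sym y₂y₃)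

  1≤b₂ : 1ℤ ≤ + b 2F
  1≤b₂ = b-positive 2F x₀y₂ x₀y₃ y₂y₃

  c₁≡1 : + c 1F ≡ 1ℤ
  c₁≡1 = begin
    + c 1F                                     ≡⟨ cong (λ i → + c i) (dist-unique 1F x₀y₁) ⟨
    + c (dist x₀ y₁)                           ≡⟨ count-c (d-unique x₀y₁) ⟨
    ∑[ z < order ] (A y₁ z * e 0 (d x₀ z))     ≡⟨ sum-cong-≗ (λ z → ℤ.*-comm (A y₁ z) (e 0 (d x₀ z))) ⟩
    F 0 (A y₁) x₀                              ≡⟨ F₀ (A y₁) x₀ ⟩
    A y₁ x₀                                    ≡⟨ T⇒⟦⟧≡1 (adj-sym x₀~y₁) ⟩
    1ℤ                                         ∎
    where open ≡-Reasoning

  b₃≡0 : + b 3F ≡ 0ℤ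
  b₃≡0 = begin
    + b 3F                                            ≡⟨ cong (λ i → + b i) (dist-unique 3F x₀y₃) ⟨
    + b (dist x₀ y₃)                                  ≡⟨ count-b x₀ y₃ ⟨
    ∑[ z < order ] (A y₃ z * e (suc (d x₀ y₃)) (d x₀ z)) ≡⟨ sum-0 far ⟩
    0ℤ                                                ∎
    where
    open ≡-Reasoning
    far : ∀ z → A y₃ z * e (suc (d x₀ y₃)) (d x₀ z) ≡ 0ℤ
    far z = trans (cong (A y₃ z *_) (e-≢ λ eq →
      ℕ.<⇒≢ (Fin.toℕ<n (dist x₀ z)) (trans eq (cong suc (d-unique x₀y₃))))) (ℤ.*-zeroʳ (A y₃ z))

-- Integer eigenvalues of real matrices

module ℚ-Sum = SemiringSum (CommutativeRing.semiring ℚ.+-*-commutativeRing)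

sumℚ : ∀ {n} → Vector ℚ n → ℚ
sumℚ = ℚ-Sum.sum

ι : ℤ → ℚ
ι i = i ℚ./ 1

-- The fraction `i / 1` is normalised by a gcd that does not reduce for a variable i. The explicit
-- normal form does reduce, which leaves integer identities in the homomorphism laws.
ι-mkℚ : ∀ i → ι i ≡ mkℚ i 0 (Coprimality.sym (Coprimality.1-coprimeTo ℤ.∣ i ∣))
ι-mkℚ i = ℚ.↥p/↧p≡p (mkℚ i 0 (Coprimality.sym (Coprimality.1-coprimeTo ℤ.∣ i ∣)))

ι-+ : ∀ i j → ι (i + j) ≡ ι i ℚ.+ ι j
ι-+ i j rewrite ι-mkℚ i | ι-mkℚ j =
  cong ι (sym (cong₂ _+_ (ℤ.*-identityʳ i) (ℤ.*-identityʳ j)))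

ι-* : ∀ i j → ι (i * j) ≡ ι i ℚ.* ι j
ι-* i j rewrite ι-mkℚ i | ι-mkℚ j = refl


ι-neg : ∀ i → ι (- i) ≡ ℚ.- ι i
ι-neg (+ zero)  = refl
ι-neg (+ suc n) = refl
ι-neg -[1+ n ]  = trans (ι-mkℚ (+ suc n)) (cong ℚ.-_ (sym (ι-mkℚ -[1+ n ])))

ι≢0 : ∀ {i} → ¬ i ≡ 0ℤ → ¬ ι i ≡ 0ℚ
ι≢0 {i} i≢0 eq = i≢0 (cong ℚ.↥_ (trans (sym (ι-mkℚ i)) eq))

ι-sum : ∀ {n} (f : Vector ℤ n) → ι (sum f) ≡ sumℚ (ι ∘ f)
ι-sum {zero}  f = refl
ι-sum {suc n} f = trans (ι-+ (f zero) (sum (f ∘ suc))) (cong (ι (f zero) ℚ.+_) (ι-sum (f ∘ suc)))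

sumℚ-≟ : ∀ {n} (V : Vector ℚ n) i q → sumℚ (λ j → ι (⟦ does (i Fin.≟ j) ⟧ * q) ℚ.* V j) ≡ ι q ℚ.* V i
sumℚ-≟ {suc n} V zero q = begin
  ι (1ℤ * q) ℚ.* V zero ℚ.+ sumℚ {n} (λ j → 0ℚ ℚ.* V (suc j))
    ≡⟨ cong₂ ℚ._+_ (cong (λ i → ι i ℚ.* V zero) (ℤ.*-identityˡ q))
         (trans (ℚ-Sum.sum-cong-≗ (λ j → ℚ.*-zeroˡ (V (suc j)))) (ℚ-Sum.sum-replicate-zero n)) ⟩
  ι q ℚ.* V zero ℚ.+ 0ℚ
    ≡⟨ ℚ.+-identityʳ _ ⟩
  ι q ℚ.* V zero ∎
  where open ≡-Reasoning
sumℚ-≟ {suc n} V (suc i) q =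
  trans (cong (ℚ._+ rest) (ℚ.*-zeroˡ (V zero))) (trans (ℚ.+-identityˡ rest) (sumℚ-≟ (V ∘ suc) i q))
  where rest = sumℚ (λ j → ι (⟦ does (i Fin.≟ j) ⟧ * q) ℚ.* V (suc j))

∣sumℚ∣≤ : ∀ {n} (f : Vector ℤ n) (r : Vector ℚ n) δ → 0ℚ ℚ.≤ δ → (∀ i → ∣ r i ∣ ℚ.≤ δ) →
          ∣ sumℚ (λ i → ι (f i) ℚ.* r i) ∣ ℚ.≤ sumℚ (λ i → ∣ ι (f i) ∣) ℚ.* δ
∣sumℚ∣≤ {zero}  f r δ 0≤δ r≤δ = ℚ.≤-reflexive (sym (ℚ.*-zeroˡ δ))
∣sumℚ∣≤ {suc n} f r δ 0≤δ r≤δ =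
  subst (∣ ι (f zero) ℚ.* r zero ℚ.+ rest ∣ ℚ.≤_) (sym (ℚ.*-distribʳ-+ δ ∣ ι (f zero) ∣ bound))
    (∣+∣-mono-≤ (ι (f zero) ℚ.* r zero) rest (∣ ι (f zero) ∣ ℚ.* δ) (bound ℚ.* δ)
      (∣*∣-mono-≤ (ι (f zero)) (r zero) ∣ ι (f zero) ∣ δ ℚ.≤-refl (r≤δ zero) 0≤δ)
      (∣sumℚ∣≤ (f ∘ suc) (r ∘ suc) δ 0≤δ (r≤δ ∘ suc)))
  where
  rest  = sumℚ (λ i → ι (f (suc i)) ℚ.* r (suc i))
  bound = sumℚ (λ i → ∣ ι (f (suc i)) ∣)

_∙ℚ_ : ∀ {n} → Vector ℤ n → Vector ℚ n → ℚ
f ∙ℚ V = sumℚ (λ i → ι (f i) ℚ.* V i)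

left-inverse-∙ℚ : ∀ {n} (W B : Fin n → Fin n → ℤ) q →
  (∀ x z → ∑[ y < n ] (W x y * B y z) ≡ ⟦ does (x Fin.≟ z) ⟧ * q) →
  ∀ V x → W x ∙ℚ (λ y → B y ∙ℚ V) ≡ ι q ℚ.* V x
left-inverse-∙ℚ {n} W B q WB V x = begin
  sumℚ (λ y → ι (W x y) ℚ.* (B y ∙ℚ V))
    ≡⟨ ℚ-Sum.sum-cong-≗ (λ y → ℚ-Sum.*-distribˡ-sum (ι (W x y)) (λ z → ι (B y z) ℚ.* V z)) ⟩
  sumℚ (λ y → sumℚ (λ z → ι (W x y) ℚ.* (ι (B y z) ℚ.* V z)))
    ≡⟨ ℚ-Sum.∑-comm (λ y z → ι (W x y) ℚ.* (ι (B y z) ℚ.* V z)) ⟩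
  sumℚ (λ z → sumℚ (λ y → ι (W x y) ℚ.* (ι (B y z) ℚ.* V z)))
    ≡⟨ ℚ-Sum.sum-cong-≗ inner ⟩
  sumℚ (λ z → ι (⟦ does (x Fin.≟ z) ⟧ * q) ℚ.* V z)
    ≡⟨ sumℚ-≟ V x q ⟩
  ι q ℚ.* V x ∎
  where
  open ≡-Reasoning
  inner : ∀ z → sumℚ (λ y → ι (W x y) ℚ.* (ι (B y z) ℚ.* V z)) ≡ ι (⟦ does (x Fin.≟ z) ⟧ * q) ℚ.* V z
  inner z = begin
    sumℚ (λ y → ι (W x y) ℚ.* (ι (B y z) ℚ.* V z))
      ≡⟨ ℚ-Sum.sum-cong-≗ (λ y → trans (sym (ℚ.*-assoc (ι (W x y)) (ι (B y z)) (V z)))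
           (cong (ℚ._* V z) (sym (ι-* (W x y) (B y z))))) ⟩
    sumℚ (λ y → ι (W x y * B y z) ℚ.* V z)
      ≡⟨ ℚ-Sum.*-distribʳ-sum (V z) (λ y → ι (W x y * B y z)) ⟨
    sumℚ (λ y → ι (W x y * B y z)) ℚ.* V z
      ≡⟨ cong (ℚ._* V z) (trans (sym (ι-sum (λ y → W x y * B y z))) (cong ι (WB x z))) ⟩
    ι (⟦ does (x Fin.≟ z) ⟧ * q) ℚ.* V z ∎

Eventually : (ℕ → Set) → Set
Eventually P = ∃[ N ] (∀ m → N ℕ.≤ m → P m)

eventually-∀ : ∀ {n} {P : Fin n → ℕ → Set} → (∀ i → Eventually (P i)) → Eventually (λ m → ∀ i → P i m)
eventually-∀ {zero}  h = 0 , λ _ _ ()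
eventually-∀ {suc n} {P} h with h zero | eventually-∀ {n} {λ i → P (suc i)} (h ∘ suc)
... | N , hN | M , hM = N ℕ.⊔ M , λ where
  m N⊔M≤m zero    → hN m (ℕ.m⊔n≤o⇒m≤o N M N⊔M≤m)
  m N⊔M≤m (suc i) → hM m (ℕ.m⊔n≤o⇒n≤o N M N⊔M≤m) i

-- W B = q I turns smallness of B v into smallness of q v, with no limits taken.
null-vector : ∀ {n} (W B : Fin n → Fin n → ℤ) q → ¬ q ≡ 0ℤ →
  (∀ x z → ∑[ y < n ] (W x y * B y z) ≡ ⟦ does (x Fin.≟ z) ⟧ * q) →
  ∀ (v : Vector ℝ n) →
  (∀ ε → 0ℚ ℚ.< ε → ∀ y → Eventually (λ m → ∣ B y ∙ℚ (λ z → seq (v z) m) ∣ ℚ.≤ ε)) →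
  ∀ x → v x ≃ 0ℝ
null-vector {n} W B q q≢0 WB v small x ε 0<ε =
  let N , close = eventually-∀ (small δ 0<δ) in N , λ m N≤m →
    subst (λ p → ∣ p ∣ ℚ.≤ ε) (sym (ℚ.+-identityʳ (seq (v x) m)))
      (ℚ.*-cancelˡ-≤-pos ∣ ι q ∣ {{∣q∣⁺}} (begin
        ∣ ι q ∣ ℚ.* ∣ seq (v x) m ∣      ≡⟨ ℚ.∣p*q∣≡∣p∣*∣q∣ (ι q) (seq (v x) m) ⟨
        ∣ ι q ℚ.* seq (v x) m ∣          ≡⟨ cong ∣_∣ (left-inverse-∙ℚ W B q WB (λ z → seq (v z) m) x) ⟨
        ∣ W x ∙ℚ (λ y → B y ∙ℚ (λ z → seq (v z) m)) ∣
          ≤⟨ ∣sumℚ∣≤ (W x) (λ y → B y ∙ℚ (λ z → seq (v z) m)) δ (ℚ.<⇒≤ 0<δ) (close m N≤m) ⟩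
        C ℚ.* δ                          ≤⟨ ℚ.*-monoʳ-≤-nonNeg δ {{ℚ.nonNegative (ℚ.<⇒≤ 0<δ)}} C≤1+C ⟩
        (1ℚ ℚ.+ C) ℚ.* δ                 ≡⟨ Cδ≡ ⟩
        ∣ ι q ∣ ℚ.* ε                    ∎))
  where
  open ℚ.≤-Reasoning
  C = sumℚ (λ y → ∣ ι (W x y) ∣)
  0≤C : 0ℚ ℚ.≤ C
  0≤C = sum-nonneg (λ y → ι (W x y))
    where
    sum-nonneg : ∀ {n} (f : Vector ℚ n) → 0ℚ ℚ.≤ sumℚ (λ i → ∣ f i ∣)
    sum-nonneg {zero}  f = ℚ.≤-refl
    sum-nonneg {suc n} f = ℚ.+-mono-≤ {0ℚ} {∣ f zero ∣} {0ℚ} (ℚ.0≤∣p∣ (f zero)) (sum-nonneg (f ∘ suc))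
  0<1+C : 0ℚ ℚ.< 1ℚ ℚ.+ C
  0<1+C = ℚ.+-mono-<-≤ {0ℚ} {1ℚ} {0ℚ} {C} (ℚ.positive⁻¹ 1ℚ) 0≤C
  C≤1+C : C ℚ.≤ 1ℚ ℚ.+ C
  C≤1+C = subst (ℚ._≤ 1ℚ ℚ.+ C) (ℚ.+-identityˡ C) (ℚ.+-monoˡ-≤ C {0ℚ} {1ℚ} (ℚ.<⇒≤ (ℚ.positive⁻¹ 1ℚ)))
  0<∣q∣ : 0ℚ ℚ.< ∣ ι q ∣
  0<∣q∣ = ℚ.≰⇒> λ ∣q∣≤0 → ι≢0 q≢0 (ℚ.∣p∣≡0⇒p≡0 (ι q) (ℚ.≤-antisym ∣q∣≤0 (ℚ.0≤∣p∣ (ι q))))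
  ∣q∣⁺ = ℚ.positive 0<∣q∣
  0<∣q∣ε : 0ℚ ℚ.< ∣ ι q ∣ ℚ.* ε
  0<∣q∣ε = subst (ℚ._< ∣ ι q ∣ ℚ.* ε) (ℚ.*-zeroʳ ∣ ι q ∣) (ℚ.*-monoʳ-<-pos ∣ ι q ∣ {{∣q∣⁺}} 0<ε)
  -- C is the sum of the absolute values in row x of W. Solving (1 + C) δ = |q| ε instead of C δ =
  -- |q| ε keeps the divisor positive when C is zero.
  scale = shrink (1ℚ ℚ.+ C) (∣ ι q ∣ ℚ.* ε) 0<1+C 0<∣q∣ε
  δ = proj₁ scale
  0<δ = proj₁ (proj₂ scale)
  Cδ≡ = proj₂ (proj₂ scale)

seq-foldr : ∀ {n} (f : Vector ℝ n) m → seq (foldr Defs._+_ 0ℝ f) m ≡ sumℚ (λ i → seq (f i) m)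
seq-foldr {zero}  f m = refl
seq-foldr {suc n} f m = cong (λ p → seq (f zero) m ℚ.+ p) (seq-foldr (λ i → f (suc i)) m)


-- If q were nonzero, W / q would be a left inverse of N - θ I and would annihilate every
-- eigenvector of θ. Equality of integers is decidable, so the argument by contradiction is
-- constructive.
integer-eigenvalue : ∀ {n} (M : Matrix n) (N : Fin n → Fin n → ℤ) →
  (∀ y z m → seq (M y z) m ≡ ι (N y z)) → ∀ θ → IsEigenvalue M (fromℤ θ) →
  ∀ (W : Fin n → Fin n → ℤ) q →
  (∀ x z → ∑[ y < n ] (W x y * (N y z + ⟦ does (y Fin.≟ z) ⟧ * - θ)) ≡ ⟦ does (x Fin.≟ z) ⟧ * q) →
  q ≡ 0ℤ
integer-eigenvalue {n} M N M≡N θ (v , v≢0 , Mv≃θv) W q WB with q ℤ.≟ 0ℤ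
... | yes q≡0 = q≡0
... | no  q≢0 = contradiction (null-vector W B q q≢0 WB v small) v≢0
  where
  B : Fin n → Fin n → ℤ
  B y z = N y z + ⟦ does (y Fin.≟ z) ⟧ * - θ
  B-∙ : ∀ (V : Vector ℚ n) y → B y ∙ℚ V ≡ N y ∙ℚ V ℚ.- ι θ ℚ.* V y
  B-∙ V y = begin
    B y ∙ℚ V
      ≡⟨ ℚ-Sum.sum-cong-≗ (λ z → trans (cong (ℚ._* V z) (ι-+ (N y z) _)) (ℚ.*-distribʳ-+ (V z) (ι (N y z)) _)) ⟩
    sumℚ (λ z → ι (N y z) ℚ.* V z ℚ.+ ι (⟦ does (y Fin.≟ z) ⟧ * - θ) ℚ.* V z)
      ≡⟨ ℚ-Sum.∑-distrib-+ (λ z → ι (N y z) ℚ.* V z) (λ z → ι (⟦ does (y Fin.≟ z) ⟧ * - θ) ℚ.* V z) ⟩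
    N y ∙ℚ V ℚ.+ sumℚ (λ z → ι (⟦ does (y Fin.≟ z) ⟧ * - θ) ℚ.* V z)
      ≡⟨ cong (λ s → N y ∙ℚ V ℚ.+ s) (trans (sumℚ-≟ V y (- θ))
           (trans (cong (ℚ._* V y) (ι-neg θ)) (sym (ℚ.neg-distribˡ-* (ι θ) (V y))))) ⟩
    N y ∙ℚ V ℚ.- ι θ ℚ.* V y ∎
    where open ≡-Reasoning
  seq-· : ∀ y m → seq ((M · v) y) m ≡ N y ∙ℚ (λ z → seq (v z) m)
  seq-· y m = trans (seq-foldr (λ z → M y z Defs.* v z) m)
    (ℚ-Sum.sum-cong-≗ λ z → cong (λ p → p ℚ.* seq (v z) m) (M≡N y z m))
  small : ∀ ε → 0ℚ ℚ.< ε → ∀ y → Eventually (λ m → ∣ B y ∙ℚ (λ z → seq (v z) m) ∣ ℚ.≤ ε)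
  small ε 0<ε y = let N , close = Mv≃θv y ε 0<ε in N , λ m N≤m →
    subst (λ p → ∣ p ∣ ℚ.≤ ε)
      (trans (cong (λ p → p ℚ.- ι θ ℚ.* seq (v y) m) (seq-· y m)) (sym (B-∙ (λ z → seq (v z) m) y)))
      (close m N≤m)

-- The eigenmatrix of a₃

≟-swap : ∀ {n} (i j : Fin n) → ⟦ does (i Fin.≟ j) ⟧ ≡ ⟦ does (j Fin.≟ i) ⟧
≟-swap i j = cong ⟦_⟧ (does-⇔ (mk⇔ sym sym) (i Fin.≟ j) (j Fin.≟ i))

module Eigenmatrix (Γ : Graph) (isDR : IsDistanceRegular Γ 3) where
  open Graph Γ
  open IsDistanceRegular isDR
  open Spectrum Γ isDR public

  θ β b₂ c₂ : ℤ
  θ  = a 3F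
  β  = θ - a 1F
  b₂ = + b 2F
  c₂ = + c 2F

  -- b₂ · β times the standard sequence 1, 1/β, 0, -c₂/(b₂ β) of θ.
  w : ℕ → ℤ
  w 0 = β * b₂
  w 1 = b₂
  w 3 = - c₂
  w _ = 0ℤ

  W : Vertex → Vertex → ℤ
  W x y = w (d x y)

  W-sym : ∀ x y → W x y ≡ W y x
  W-sym x y = cong w (d-sym x y)

  defect : ℤ
  defect = b₂ * (+ k - θ * β)

  -- Distances 1, 2 and 3 give identities, by the choices β = θ - a₁, w 3 = - c₂ and θ = a₃
  -- respectively, together with w 2 = 0. Distance 0 alone imposes a condition, and `defect`
  -- measures its failure. The vertex serves to obtain c 0 = 0.
  Lw : Vertex → ∀ i → L w i ≡ θ * w (toℕ i) + e 0 (toℕ i) * defect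
  Lw x 0F rewrite c₀≡0 x = ring (+ k) θ β b₂
    where
    ring : ∀ k θ β b₂ → 0ℤ * (β * b₂) + (k - k - 0ℤ) * (β * b₂) + k * b₂ ≡
           θ * (β * b₂) + 1ℤ * (b₂ * (k - θ * β))
    ring = solve-∀
  Lw x 1F = trans (cong (λ c₁ → c₁ * w 0 + a 1F * b₂ + + b 1F * 0ℤ) c₁≡1) (ring θ (a 1F) (+ b 1F) b₂ defect)
    where
    ring : ∀ θ a₁ b₁ b₂ q → 1ℤ * ((θ - a₁) * b₂) + a₁ * b₂ + b₁ * 0ℤ ≡ θ * b₂ + 0ℤ * q
    ring = solve-∀
  Lw x 2F = ring θ (a 2F) b₂ c₂ defect
    where
    ring : ∀ θ a₂ b₂ c₂ q → c₂ * b₂ + a₂ * 0ℤ + b₂ * - c₂ ≡ θ * 0ℤ + 0ℤ * q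
    ring = solve-∀
  Lw x 3F = ring θ (+ c 3F) (+ b 3F) c₂ defect
    where
    ring : ∀ θ c₃ b₃ c₂ q → c₃ * 0ℤ + θ * - c₂ + b₃ * 0ℤ ≡ θ * - c₂ + 0ℤ * q
    ring = solve-∀

  A-θI : Vertex → Vertex → ℤ
  A-θI y z = A y z + ⟦ does (y Fin.≟ z) ⟧ * - θ

  AW : ∀ x z → ∑[ y < order ] (A z y * W x y) ≡ θ * W x z + e 0 (d x z) * defect
  AW x z = trans (three-term w x z) (Lw x (dist x z))

  W[A-θI] : ∀ x z → ∑[ y < order ] (W x y * A-θI y z) ≡ ⟦ does (x Fin.≟ z) ⟧ * defect
  W[A-θI] x z = begin
    ∑[ y < order ] (W x y * A-θI y z)
      ≡⟨ sum-cong-≗ (λ y → trans (cong₂ (λ p q → W x y * (p + q * - θ)) (A-sym y z) (≟-swap y z))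
           (expand (W x y) (A z y) ⟦ does (z Fin.≟ y) ⟧ θ)) ⟩
    ∑[ y < order ] (A z y * W x y - θ * (⟦ does (z Fin.≟ y) ⟧ * W x y))
      ≡⟨ ∑-distrib-- (λ y → A z y * W x y) (λ y → θ * (⟦ does (z Fin.≟ y) ⟧ * W x y)) ⟩
    ∑[ y < order ] (A z y * W x y) - ∑[ y < order ] (θ * (⟦ does (z Fin.≟ y) ⟧ * W x y))
      ≡⟨ cong₂ _-_ (AW x z) (trans (sym (*-distribˡ-sum θ (λ y → ⟦ does (z Fin.≟ y) ⟧ * W x y)))
           (cong (θ *_) (sum-≟ (W x) z))) ⟩
    θ * W x z + e 0 (d x z) * defect - θ * W x z
      ≡⟨ cancel (θ * W x z) (e 0 (d x z) * defect) ⟩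
    e 0 (d x z) * defect
      ≡⟨ cong (λ b → ⟦ b ⟧ * defect)
           (does-⇔ (mk⇔ d≡0⇒≡ (λ { refl → d-refl x })) (d x z ℕ.≟ 0) (x Fin.≟ z)) ⟩
    ⟦ does (x Fin.≟ z) ⟧ * defect ∎
    where
    open ≡-Reasoning
    expand : ∀ w a i θ → w * (a + i * - θ) ≡ a * w - θ * (i * w)
    expand = solve-∀
    cancel : ∀ p q → p + q - p ≡ q
    cancel = solve-∀

  adjacencyMatrix≡A : ∀ y z m → seq (Defs.adjacencyMatrix Γ y z) m ≡ ι (A y z)
  adjacencyMatrix≡A y z m with adj y z
  ... | true  = refl
  ... | false = refl

  -- W (A - θ I) is `defect` times the identity, so an eigenvector of θ forces `defect` to vanish;
  -- its factor b₂ is positive.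
  eigenvalue⇒k≡θβ : IsEigenvalue (Defs.adjacencyMatrix Γ) (fromℤ θ) → + k ≡ θ * β
  eigenvalue⇒k≡θβ θ-eigenvalue = ℤ.i-j≡0⇒i≡j (+ k) (θ * β)
    (*-cancelˡ-≡ (ℤ.<-≤-trans (+<+ (s≤s z≤n)) 1≤b₂)
      (trans (integer-eigenvalue (Defs.adjacencyMatrix Γ) A adjacencyMatrix≡A θ θ-eigenvalue W defect W[A-θI])
        (sym (ℤ.*-zeroʳ b₂))))

-- Intersection numbers and eigenfunctions when k = θ β

*-cancelʳ-< : ∀ {i j k} → 0ℤ ≤ k → i * k < j * k → i < j
*-cancelʳ-< {i} {j} {k} 0≤k = ℤ.*-cancelʳ-<-nonNeg {i} {j} k {{nonNegative 0≤k}}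

module ShillaGraph (Γ : Graph) (isDR : IsDistanceRegular Γ 3)
  (k≡θβ : + IsDistanceRegular.k isDR ≡ Eigenmatrix.θ Γ isDR * Eigenmatrix.β Γ isDR)
  (2≤β : + 2 ≤ Eigenmatrix.β Γ isDR) where
  open Graph Γ
  open IsDistanceRegular isDR
  open Eigenmatrix Γ isDR public

  0≤β : 0ℤ ≤ β
  0≤β = ℤ.≤-trans (+≤+ z≤n) 2≤β

  0<θ : 0ℤ < θ
  0<θ = *-cancelʳ-< 0≤β (subst (0ℤ <_) k≡θβ (ℤ.<-≤-trans (+<+ (s≤s z≤n)) 1≤k))

  0≤θ : 0ℤ ≤ θ
  0≤θ = ℤ.<⇒≤ 0<θ

  0<b₂ : 0ℤ < b₂
  0<b₂ = ℤ.<-≤-trans (+<+ (s≤s z≤n)) 1≤b₂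

  0<c₂ : 0ℤ < c₂
  0<c₂ = ℤ.<-≤-trans (+<+ (s≤s z≤n)) 1≤c₂

  c₃≡ : + c 3F ≡ θ * (β - 1ℤ)
  c₃≡ = begin
    + c 3F                                       ≡⟨ ring₁ (+ k) (+ b 3F) (+ c 3F) ⟩
    + k - (+ k - + b 3F - + c 3F) - + b 3F        ≡⟨ cong₂ (λ k b₃ → k - θ - b₃) k≡θβ b₃≡0 ⟩
    θ * β - θ - 0ℤ                               ≡⟨ ring₂ θ β ⟩
    θ * (β - 1ℤ)                                 ∎
    where
    open ≡-Reasoning
    ring₁ : ∀ k b c → c ≡ k - (k - b - c) - b
    ring₁ = solve-∀
    ring₂ : ∀ θ β → θ * β - θ - 0ℤ ≡ θ * (β - 1ℤ)
    ring₂ = solve-∀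

  a₁≡ : a 1F ≡ θ - β
  a₁≡ = ring θ (a 1F)
    where
    ring : ∀ θ a → a ≡ θ - (θ - a)
    ring = solve-∀

  b₁≡ : + b 1F ≡ (θ + 1ℤ) * (β - 1ℤ)
  b₁≡ = begin
    + b 1F                                       ≡⟨ ring₁ (+ k) (+ b 1F) (+ c 1F) ⟩
    + k - (+ k - + b 1F - + c 1F) - + c 1F        ≡⟨ cong₂ (λ k a₁ → k - a₁ - + c 1F) k≡θβ a₁≡ ⟩
    θ * β - (θ - β) - + c 1F                      ≡⟨ cong (λ c₁ → θ * β - (θ - β) - c₁) c₁≡1 ⟩
    θ * β - (θ - β) - 1ℤ                         ≡⟨ ring₂ θ β ⟩
    (θ + 1ℤ) * (β - 1ℤ)                          ∎
    where
    open ≡-Reasoning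
    ring₁ : ∀ k b c → b ≡ k - (k - b - c) - c
    ring₁ = solve-∀
    ring₂ : ∀ θ β → θ * β - (θ - β) - 1ℤ ≡ (θ + 1ℤ) * (β - 1ℤ)
    ring₂ = solve-∀

  -- Sphere sums of an eigenfunction in terms of its value at the centre. The eigenvalue is left
  -- general because two are needed: θ with the rows of W, and k with the constant function, whose
  -- sphere sums are the sphere sizes.
  module _ (g : Vertex → ℤ) (μ : ℤ) (eigen : IsEigenfunction g μ) (x : Vertex) where
    F₁ : F 1 g x ≡ μ * g x
    F₁ = begin
      F 1 g x
        -- The right-hand side is `L (e 0)` unfolded at the four distances, with the values c 0 = 0
        -- and c 1 = 1 already inserted.
        ≡⟨ ring (+ k) (F 0 g x) (F 1 g x) (F 2 g x) (F 3 g x) (a 1F) (+ b 1F) (a 2F) c₂ b₂ (+ c 3F) (a 3F) (+ b 3F) ⟩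
      (0ℤ * 1ℤ + (+ k - + k - 0ℤ) * 1ℤ + + k * 0ℤ) * F 0 g x + (1ℤ * 1ℤ + a 1F * 0ℤ + + b 1F * 0ℤ) * F 1 g x
        + (c₂ * 0ℤ + a 2F * 0ℤ + b₂ * 0ℤ) * F 2 g x + (+ c 3F * 0ℤ + a 3F * 0ℤ + + b 3F * 0ℤ) * F 3 g x
        ≡⟨ cong₂ (λ c₀ c₁ → (c₀ * 1ℤ + (+ k - + k - c₀) * 1ℤ + + k * 0ℤ) * F 0 g x
             + (c₁ * 1ℤ + a 1F * 0ℤ + + b 1F * 0ℤ) * F 1 g x
             + (c₂ * 0ℤ + a 2F * 0ℤ + b₂ * 0ℤ) * F 2 g x + (+ c 3F * 0ℤ + a 3F * 0ℤ + + b 3F * 0ℤ) * F 3 g x)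
             (cong +_ (sym (c₀≡0 x))) (sym c₁≡1) ⟩
      L (e 0) 0F * F 0 g x + L (e 0) 1F * F 1 g x + L (e 0) 2F * F 2 g x + L (e 0) 3F * F 3 g x
        ≡⟨ F-recurrence g μ eigen 0 x ⟩
      μ * F 0 g x
        ≡⟨ cong (μ *_) (F₀ g x) ⟩
      μ * g x ∎
      where
      open ≡-Reasoning
      ring : ∀ k F₀ F₁ F₂ F₃ a₁ b₁ a₂ c₂ b₂ c₃ a₃ b₃ → F₁ ≡
        (0ℤ * 1ℤ + (k - k - 0ℤ) * 1ℤ + k * 0ℤ) * F₀ + (1ℤ * 1ℤ + a₁ * 0ℤ + b₁ * 0ℤ) * F₁
        + (c₂ * 0ℤ + a₂ * 0ℤ + b₂ * 0ℤ) * F₂ + (c₃ * 0ℤ + a₃ * 0ℤ + b₃ * 0ℤ) * F₃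
      ring = solve-∀

    F₂ : c₂ * F 2 g x ≡ (μ * μ - a 1F * μ - + k) * g x
    F₂ = begin
      c₂ * F 2 g x
        ≡⟨ ring₁ (+ k) (F 0 g x) (F 1 g x) (F 2 g x) (F 3 g x) (+ c 0F) (a 0F) (+ c 1F) (a 1F) (+ b 1F) (a 2F) c₂ b₂ (+ c 3F) (a 3F) (+ b 3F) ⟩
      (L (e 1) 0F * F 0 g x + L (e 1) 1F * F 1 g x + L (e 1) 2F * F 2 g x + L (e 1) 3F * F 3 g x)
        - a 1F * F 1 g x - + k * F 0 g x
        ≡⟨ cong (λ s → s - a 1F * F 1 g x - + k * F 0 g x) (F-recurrence g μ eigen 1 x) ⟩
      μ * F 1 g x - a 1F * F 1 g x - + k * F 0 g x
        ≡⟨ cong₂ (λ s t → μ * s - a 1F * s - + k * t) F₁ (F₀ g x) ⟩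
      μ * (μ * g x) - a 1F * (μ * g x) - + k * g x
        ≡⟨ ring₂ μ (a 1F) (+ k) (g x) ⟩
      (μ * μ - a 1F * μ - + k) * g x ∎
      where
      open ≡-Reasoning
      ring₁ : ∀ k F₀ F₁ F₂ F₃ c₀ a₀ c₁ a₁ b₁ a₂ c₂ b₂ c₃ a₃ b₃ → c₂ * F₂ ≡
        ((c₀ * 0ℤ + a₀ * 0ℤ + k * 1ℤ) * F₀ + (c₁ * 0ℤ + a₁ * 1ℤ + b₁ * 0ℤ) * F₁
        + (c₂ * 1ℤ + a₂ * 0ℤ + b₂ * 0ℤ) * F₂ + (c₃ * 0ℤ + a₃ * 0ℤ + b₃ * 0ℤ) * F₃) - a₁ * F₁ - k * F₀
      ring₁ = solve-∀
      ring₂ : ∀ μ a₁ k g → μ * (μ * g) - a₁ * (μ * g) - k * g ≡ (μ * μ - a₁ * μ - k) * g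
      ring₂ = solve-∀

    F₃ : + c 3F * F 3 g x ≡ (μ - a 2F) * F 2 g x - + b 1F * (μ * g x)
    F₃ = begin
      + c 3F * F 3 g x
        ≡⟨ ring₁ (+ k) (F 0 g x) (F 1 g x) (F 2 g x) (F 3 g x) (+ c 0F) (a 0F) (+ c 1F) (a 1F) (+ b 1F) (a 2F) c₂ b₂ (+ c 3F) (a 3F) (+ b 3F) ⟩
      (L (e 2) 0F * F 0 g x + L (e 2) 1F * F 1 g x + L (e 2) 2F * F 2 g x + L (e 2) 3F * F 3 g x)
        - a 2F * F 2 g x - + b 1F * F 1 g x
        ≡⟨ cong₂ (λ s t → s - a 2F * F 2 g x - + b 1F * t) (F-recurrence g μ eigen 2 x) F₁ ⟩
      μ * F 2 g x - a 2F * F 2 g x - + b 1F * (μ * g x)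
        ≡⟨ ring₂ μ (a 2F) (F 2 g x) (+ b 1F * (μ * g x)) ⟩
      (μ - a 2F) * F 2 g x - + b 1F * (μ * g x) ∎
      where
      open ≡-Reasoning
      ring₁ : ∀ k F₀ F₁ F₂ F₃ c₀ a₀ c₁ a₁ b₁ a₂ c₂ b₂ c₃ a₃ b₃ → c₃ * F₃ ≡
        ((c₀ * 0ℤ + a₀ * 0ℤ + k * 0ℤ) * F₀ + (c₁ * 0ℤ + a₁ * 0ℤ + b₁ * 1ℤ) * F₁
        + (c₂ * 0ℤ + a₂ * 1ℤ + b₂ * 0ℤ) * F₂ + (c₃ * 1ℤ + a₃ * 0ℤ + b₃ * 0ℤ) * F₃) - a₂ * F₂ - b₁ * F₁
      ring₁ = solve-∀
      ring₂ : ∀ μ a₂ F₂ r → μ * F₂ - a₂ * F₂ - r ≡ (μ - a₂) * F₂ - r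
      ring₂ = solve-∀

  0<β-1 : 0ℤ < β - 1ℤ
  0<β-1 = ℤ.<-≤-trans (+<+ (s≤s z≤n)) (ℤ.+-monoˡ-≤ (- 1ℤ) 2≤β)

  0<c₃ : 0ℤ < + c 3F
  0<c₃ = ℤ.<-≤-trans (+<+ (s≤s z≤n)) 1≤c₃

  module _ (g : Vertex → ℤ) (eigen : IsEigenfunction g θ) (x : Vertex) where
    -- The vanishing third term of the standard sequence again: θ² - a₁ θ - k = θ (θ - a₁ - β) = 0.
    F₂-θ : F 2 g x ≡ 0ℤ
    F₂-θ = *-cancelˡ-≡ 0<c₂ (begin
      c₂ * F 2 g x                         ≡⟨ F₂ g θ eigen x ⟩
      (θ * θ - a 1F * θ - + k) * g x        ≡⟨ cong (λ k → (θ * θ - a 1F * θ - k) * g x) k≡θβ ⟩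
      (θ * θ - a 1F * θ - θ * β) * g x      ≡⟨ ring θ (a 1F) (g x) c₂ ⟩
      c₂ * 0ℤ                              ∎)
      where
      open ≡-Reasoning
      ring : ∀ θ a₁ g c₂ → (θ * θ - a₁ * θ - θ * (θ - a₁)) * g ≡ c₂ * 0ℤ
      ring = solve-∀

    F₃-θ : F 3 g x ≡ - (θ + 1ℤ) * g x
    F₃-θ = *-cancelˡ-≡ 0<c₃ (begin
      + c 3F * F 3 g x
        ≡⟨ F₃ g θ eigen x ⟩
      (θ - a 2F) * F 2 g x - + b 1F * (θ * g x)
        ≡⟨ cong₂ (λ s b₁ → (θ - a 2F) * s - b₁ * (θ * g x)) F₂-θ b₁≡ ⟩
      (θ - a 2F) * 0ℤ - (θ + 1ℤ) * (β - 1ℤ) * (θ * g x)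
        ≡⟨ ring θ (a 2F) β (g x) ⟩
      θ * (β - 1ℤ) * (- (θ + 1ℤ) * g x)
        ≡⟨ cong (_* (- (θ + 1ℤ) * g x)) c₃≡ ⟨
      + c 3F * (- (θ + 1ℤ) * g x) ∎)
      where
      open ≡-Reasoning
      ring : ∀ θ a₂ β g → (θ - a₂) * 0ℤ - (θ + 1ℤ) * (β - 1ℤ) * (θ * g) ≡ θ * (β - 1ℤ) * (- (θ + 1ℤ) * g)
      ring = solve-∀

  W-isEigenfunction : ∀ y → IsEigenfunction (W y) θ
  W-isEigenfunction y x = begin
    ∑[ z < order ] (A x z * W y z)                 ≡⟨ AW y x ⟩
    θ * W y x + e 0 (d y x) * (b₂ * (+ k - θ * β))  ≡⟨ cong (λ k → θ * W y x + e 0 (d y x) * (b₂ * (k - θ * β))) k≡θβ ⟩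
    θ * W y x + e 0 (d y x) * (b₂ * (θ * β - θ * β)) ≡⟨ ring (θ * W y x) (e 0 (d y x)) b₂ (θ * β) ⟩
    θ * W y x                                      ∎
    where
    open ≡-Reasoning
    ring : ∀ p e b q → p + e * (b * (q - q)) ≡ p
    ring = solve-∀

  -- The values of w weighted by 1, θ, 0, -(θ + 1), which are the sphere sums of a θ-eigenfunction
  -- relative to its value at the centre.
  S : ℤ
  S = b₂ * (β + θ) + c₂ * (θ + 1ℤ)

  W∙W : ∀ x y → W x ∙ W y ≡ S * W x y
  W∙W x y = begin
    W x ∙ W y
      ≡⟨ radial-sum (λ i → w (toℕ i)) (W y) x ⟩
    β * b₂ * F 0 (W y) x + b₂ * F 1 (W y) x + 0ℤ * F 2 (W y) x + - c₂ * F 3 (W y) x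
      ≡⟨ cong₂ _+_ (cong₂ (λ s t → β * b₂ * s + b₂ * t + 0ℤ * F 2 (W y) x) (F₀ (W y) x)
           (F₁ (W y) θ (W-isEigenfunction y) x)) (cong (- c₂ *_) (F₃-θ (W y) (W-isEigenfunction y) x)) ⟩
    β * b₂ * W y x + b₂ * (θ * W y x) + 0ℤ * F 2 (W y) x + - c₂ * (- (θ + 1ℤ) * W y x)
      ≡⟨ ring β b₂ θ c₂ (F 2 (W y) x) (W y x) ⟩
    S * W y x
      ≡⟨ cong (S *_) (W-sym y x) ⟩
    S * W x y ∎
    where
    open ≡-Reasoning
    ring : ∀ β b₂ θ c₂ F g → β * b₂ * g + b₂ * (θ * g) + 0ℤ * F + - c₂ * (- (θ + 1ℤ) * g) ≡
           (b₂ * (β + θ) + c₂ * (θ + 1ℤ)) * g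
    ring = solve-∀

-- The Koolen–Park bound

⟦⟧-mono : ∀ {b c} → (T b → T c) → ⟦ b ⟧ ≤ ⟦ c ⟧
⟦⟧-mono {false} {c}     _   = ⟦⟧-nonNeg c
⟦⟧-mono {true}  {true}  _   = ℤ.≤-refl
⟦⟧-mono {true}  {false} b⇒c = ⊥-elim (b⇒c tt)

card : ∀ {n} → (Fin n → Bool) → ℤ
card {n} p = ∑[ i < n ] ⟦ p i ⟧

card-∨ : ∀ {n} (p q : Fin n → Bool) → card (λ i → p i ∨ q i) ≡ card p + card q - card (λ i → p i ∧ q i)
card-∨ {n} p q = begin
  card (λ i → p i ∨ q i)
    ≡⟨ sum-cong-≗ (λ i → pointwise (p i) (q i)) ⟩
  ∑[ i < n ] (⟦ p i ⟧ + ⟦ q i ⟧ - ⟦ p i ∧ q i ⟧)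
    ≡⟨ ∑-distrib-- (λ i → ⟦ p i ⟧ + ⟦ q i ⟧) (λ i → ⟦ p i ∧ q i ⟧) ⟩
  ∑[ i < n ] (⟦ p i ⟧ + ⟦ q i ⟧) - card (λ i → p i ∧ q i)
    ≡⟨ cong (_- card (λ i → p i ∧ q i)) (∑-distrib-+ (⟦_⟧ ∘ p) (⟦_⟧ ∘ q)) ⟩
  card p + card q - card (λ i → p i ∧ q i) ∎
  where
  open ≡-Reasoning
  pointwise : ∀ b c → ⟦ b ∨ c ⟧ ≡ ⟦ b ⟧ + ⟦ c ⟧ - ⟦ b ∧ c ⟧
  pointwise true  true  = refl
  pointwise true  false = refl
  pointwise false true  = refl
  pointwise false false = refl

card-mono : ∀ {n} {p q : Fin n → Bool} → (∀ i → T (p i) → T (q i)) → card p ≤ card q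
card-mono {p = p} {q} p⇒q = sum-mono-≤ {f = ⟦_⟧ ∘ p} {g = ⟦_⟧ ∘ q} (λ i → ⟦⟧-mono (p⇒q i))

card-nonNeg : ∀ {n} (p : Fin n → Bool) → 0ℤ ≤ card p
card-nonNeg p = sum-nonNeg {f = ⟦_⟧ ∘ p} (λ i → ⟦⟧-nonNeg (p i))

any-of : ∀ {n} {A : Set} → (A → Fin n → Bool) → List A → Fin n → Bool
any-of N []       z = false
any-of N (y ∷ ys) z = N y z ∨ any-of N ys z

card-any-of-∧ : ∀ {n} {A : Set} (N : A → Fin n → Bool) t (p : Fin n → Bool) {ys} →
                All (λ y → card (λ z → p z ∧ N y z) ≤ t) ys →
                card (λ z → p z ∧ any-of N ys z) ≤ + length ys * t
card-any-of-∧ {n} N t p [] = ℤ.≤-reflexive (trans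
  (sum-0 {n} {λ z → ⟦ p z ∧ false ⟧} (λ z → cong ⟦_⟧ (∧-zeroʳ (p z)))) (sym (ℤ.*-zeroˡ t)))
card-any-of-∧ {n} N t p {y ∷ ys} (h ∷ hs) = begin
  card (λ z → p z ∧ (N y z ∨ any-of N ys z))
    ≡⟨ sum-cong-≗ (λ z → cong ⟦_⟧ (∧-distribˡ-∨ (p z) (N y z) (any-of N ys z))) ⟩
  card (λ z → p z ∧ N y z ∨ p z ∧ any-of N ys z)
    ≡⟨ card-∨ (λ z → p z ∧ N y z) (λ z → p z ∧ any-of N ys z) ⟩
  card (λ z → p z ∧ N y z) + card (λ z → p z ∧ any-of N ys z) - card meet
    ≤⟨ ≤-from-difference (card meet) (card-nonNeg meet)
         (cancel (card (λ z → p z ∧ N y z) + card (λ z → p z ∧ any-of N ys z)) (card meet)) ⟩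
  card (λ z → p z ∧ N y z) + card (λ z → p z ∧ any-of N ys z)
    ≤⟨ ℤ.+-mono-≤ h (card-any-of-∧ N t p hs) ⟩
  t + + length ys * t
    ≡⟨ ℤ.suc-* (+ length ys) t ⟨
  + suc (length ys) * t ∎
  where
  open ℤ.≤-Reasoning
  meet : Fin n → Bool
  meet z = (p z ∧ N y z) ∧ (p z ∧ any-of N ys z)
  cancel : ∀ s o → s - (s - o) ≡ o
  cancel = solve-∀

any-of-⇒ : ∀ {n} {A : Set} (N : A → Fin n → Bool) (p : Fin n → Bool) →
           (∀ y z → T (N y z) → T (p z)) → ∀ ys z → T (any-of N ys z) → T (p z)
any-of-⇒ N p N⇒p (y ∷ ys) z h with N y z in eq
... | true  = N⇒p y z (subst T (sym eq) tt)
... | false = any-of-⇒ N p N⇒p ys z h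

¬any-of : ∀ {n} {A : Set} (N : A → Fin n → Bool) ys z → ¬ T (any-of N ys z) → All (λ y → ¬ T (N y z)) ys
¬any-of N []       z h = []
¬any-of N (y ∷ ys) z h with N y z in eq
... | true  = ⊥-elim (h tt)
... | false = subst T eq ∷ ¬any-of N ys z h

-- The number j (j - 1) / 2 of pairs among j objects.
triangular : ℕ → ℕ
triangular zero    = 0
triangular (suc j) = j ℕ.+ triangular j

module Coclique (Γ : Graph) (isDR : IsDistanceRegular Γ 3) where
  open Graph Γ
  open IsDistanceRegular isDR
  open Eigenmatrix Γ isDR

  common : Vertex → Vertex → ℤ
  common x y = ∑[ z < order ] (A x z * A y z)

  common≡L : ∀ x y → common x y ≡ L (e 1) (dist x y)
  common≡L x y = trans (sum-cong-≗ (λ z → trans (ℤ.*-comm (A x z) (A y z)) (cong (A y z *_) (A≡e₁ x z))))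
    (three-term (e 1) x y)

  common-adj : ∀ {x y} → T (adj x y) → common x y ≡ a 1F
  common-adj {x} {y} xy = trans (common≡L x y) (trans (cong (L (e 1)) (Fin.toℕ-injective (adj⇒d≡1 xy)))
    (ring (+ c 1F) (a 1F) (+ b 1F)))
    where
    ring : ∀ c a b → c * 0ℤ + a * 1ℤ + b * 0ℤ ≡ a
    ring = solve-∀

  common-2 : ∀ {x y} → d x y ≡ 2 → common x y ≡ c₂
  common-2 {x} {y} d≡2 = trans (common≡L x y) (trans (cong (L (e 1)) (Fin.toℕ-injective d≡2))
    (ring c₂ (a 2F) b₂))
    where
    ring : ∀ c a b → c * 1ℤ + a * 0ℤ + b * 0ℤ ≡ c
    ring = solve-∀

  nonadjacent⇒d≡2 : ∀ {x y y′} → T (adj x y) → T (adj x y′) → ¬ y ≡ y′ → ¬ T (adj y y′) → d y y′ ≡ 2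
  nonadjacent⇒d≡2 {x} {y} {y′} xy xy′ y≢y′ ¬yy′ with d y y′ in eq | adj⇒d≤ {y} xy′
  ... | 0 | _ = contradiction (d≡0⇒≡ eq) y≢y′
  ... | 1 | _ = contradiction (d≡1⇒adj eq) ¬yy′
  ... | 2 | _ = refl
  ... | suc (suc (suc _)) | le with subst (λ m → 3 ℕ.≤ suc m) (adj⇒d≡1 (adj-sym xy)) (ℕ.≤-trans (s≤s (s≤s (s≤s z≤n))) le)
  ... | s≤s (s≤s ())

  closedNbhd : Vertex → Vertex → Vertex → Bool
  closedNbhd x y z = adj x z ∧ (does (y Fin.≟ z) ∨ adj y z)

  card-closedNbhd : ∀ {x y} → T (adj x y) → card (closedNbhd x y) ≡ 1ℤ + a 1F
  card-closedNbhd {x} {y} xy = begin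
    card (closedNbhd x y)
      ≡⟨ sum-cong-≗ pointwise ⟩
    ∑[ z < order ] (⟦ does (y Fin.≟ z) ⟧ * A x z + A x z * A y z)
      ≡⟨ ∑-distrib-+ (λ z → ⟦ does (y Fin.≟ z) ⟧ * A x z) (λ z → A x z * A y z) ⟩
    ∑[ z < order ] (⟦ does (y Fin.≟ z) ⟧ * A x z) + common x y
      ≡⟨ cong₂ _+_ (trans (sum-≟ (A x) y) (T⇒⟦⟧≡1 xy)) (common-adj xy) ⟩
    1ℤ + a 1F ∎
    where
    open ≡-Reasoning
    bool : ∀ b c → ⟦ b ∧ c ⟧ ≡ 0ℤ * ⟦ b ⟧ + ⟦ b ⟧ * ⟦ c ⟧
    bool true  true  = refl
    bool true  false = refl
    bool false true  = refl
    bool false false = refl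
    pointwise : ∀ z → ⟦ closedNbhd x y z ⟧ ≡ ⟦ does (y Fin.≟ z) ⟧ * A x z + A x z * A y z
    pointwise z with y Fin.≟ z
    ... | no  _    = bool (adj x z) (adj y z)
    ... | yes refl rewrite loopless y with adj x y
    ...   | true  = refl
    ...   | false = refl

  -- Nonadjacent neighbours y, y′ of x are at distance 2 and have c₂ common neighbours. One of these
  -- is x, which is not in its own neighbourhood; and neither y nor y′ lies in the closed
  -- neighbourhood of the other.
  closedNbhd-overlap : ∀ {x y y′} → T (adj x y) → T (adj x y′) → ¬ y ≡ y′ → ¬ T (adj y y′) →
                       card (λ z → closedNbhd x y z ∧ closedNbhd x y′ z) ≤ c₂ - 1ℤ
  closedNbhd-overlap {x} {y} {y′} xy xy′ y≢y′ ¬yy′ = ≤-from-difference (c₂ - 1ℤ - meet)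
    (subst (0ℤ ≤_) (ring c₂ meet) (ℤ.i≤j⇒0≤j-i (begin
      meet + 1ℤ
        ≡⟨ cong (λ i → meet + i) (sum-≟ (λ _ → 1ℤ) x) ⟨
      meet + ∑[ z < order ] (⟦ does (x Fin.≟ z) ⟧ * 1ℤ)
        ≡⟨ ∑-distrib-+ (λ z → ⟦ both z ⟧) (λ z → ⟦ does (x Fin.≟ z) ⟧ * 1ℤ) ⟨
      ∑[ z < order ] (⟦ both z ⟧ + ⟦ does (x Fin.≟ z) ⟧ * 1ℤ)
        ≤⟨ sum-mono-≤ pointwise ⟩
      common y y′
        ≡⟨ common-2 (nonadjacent⇒d≡2 xy xy′ y≢y′ ¬yy′) ⟩
      c₂ ∎))) refl
    where
    open ℤ.≤-Reasoning
    both : Vertex → Bool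
    both z = closedNbhd x y z ∧ closedNbhd x y′ z
    meet : ℤ
    meet = card both
    ring : ∀ c o → c - (o + 1ℤ) ≡ c - 1ℤ - o
    ring = solve-∀
    generic : ∀ b₁ b₂ b₃ → (T b₁ → T b₂ × T b₃) → ⟦ b₁ ⟧ + 0ℤ * 1ℤ ≤ ⟦ b₂ ⟧ * ⟦ b₃ ⟧
    generic false b₂ b₃ h = 0≤i*j (⟦⟧-nonNeg b₂) (⟦⟧-nonNeg b₃)
    generic true true true h = ℤ.≤-refl
    generic true false b₃ h = ⊥-elim (proj₁ (h tt))
    generic true true false h = ⊥-elim (proj₂ (h tt))
    both⇒ : ∀ z → T (both z) → T (adj y z) × T (adj y′ z)
    both⇒ z h with adj x z | y Fin.≟ z | y′ Fin.≟ z | adj y z in yz | adj y′ z in y′z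
    ... | true | yes refl | yes refl | _    | _    = ⊥-elim (y≢y′ refl)
    ... | true | yes refl | no _     | _    | true = ⊥-elim (¬yy′ (adj-sym (subst T (sym y′z) tt)))
    ... | true | no _     | yes refl | true | _    = ⊥-elim (¬yy′ (subst T (sym yz) tt))
    ... | true | no _     | no _     | true | true = tt , tt
    pointwise : ∀ z → ⟦ both z ⟧ + ⟦ does (x Fin.≟ z) ⟧ * 1ℤ ≤ A y z * A y′ z
    pointwise z with x Fin.≟ z
    ... | no  _    = generic (both z) (adj y z) (adj y′ z) (both⇒ z)
    ... | yes refl rewrite loopless x | T⇒⟦⟧≡1 (adj-sym xy) | T⇒⟦⟧≡1 (adj-sym xy′) = ℤ.≤-refl

  -- The vertices ys form a coclique in the neighbourhood of x, so two of their closed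
  -- neighbourhoods there share at most t vertices. As long as these do not cover the
  -- neighbourhood of x, the coclique can be extended.
  module Greedy (x : Vertex) where
    s t : ℤ
    s = 1ℤ + a 1F
    t = c₂ - 1ℤ

    -- `upper` guarantees a vertex that is not yet covered; `lower` is a Bonferroni inequality, with
    -- one overlap of at most t for each pair. Nonadjacency is not stored: it is used only at the
    -- moment a vertex is added, and its effect is then contained in `lower`.
    record Stage (j : ℕ) : Set where
      field
        ys       : List Vertex
        size     : length ys ≡ j
        adjacent : All (λ y → T (adj x y)) ys
        upper    : card (any-of (closedNbhd x) ys) ≤ + j * s
        lower    : + j * s ≤ card (any-of (closedNbhd x) ys) + + triangular j * t

    closedNbhd⇒adj : ∀ y z → T (closedNbhd x y z) → T (adj x z)
    closedNbhd⇒adj y z h with adj x z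
    ... | true = tt

    uncovered : ∀ ys → card (any-of (closedNbhd x) ys) < + k →
                ∃ λ y → T (adj x y) × ¬ T (any-of (closedNbhd x) ys y)
    uncovered ys lt with Fin.any? (λ y → T? (adj x y) ×-dec ¬? (T? (any-of (closedNbhd x) ys y)))
    ... | yes found = found
    ... | no  none  = contradiction (subst (_≤ card (any-of (closedNbhd x) ys)) (∑A≡k x)
      (card-mono λ z xz → decidable-stable (T? (any-of (closedNbhd x) ys z)) λ ¬z → none (z , xz , ¬z)))
      (ℤ.<⇒≱ lt)

    extend : ∀ {j} → + j * s < + k → Stage j → Stage (suc j)
    extend {j} js<k stage = record
      { ys       = y ∷ ys
      ; size     = cong suc size
      ; adjacent = xy ∷ adjacent
      ; upper    = begin
          card (any-of (closedNbhd x) (y ∷ ys))  ≡⟨ cardinality ⟩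
          s + U - O                              ≤⟨ ≤-from-difference (O + (+ j * s - U))
                                                      (0≤i+j (card-nonNeg meet) (ℤ.i≤j⇒0≤j-i upper)) (ring₁ (+ j) s U O) ⟩
          (1ℤ + + j) * s                          ∎
      ; lower    = begin
          (1ℤ + + j) * s
            ≤⟨ ≤-from-difference ((U + + triangular j * t - + j * s) + (+ j * t - O))
                 (0≤i+j (ℤ.i≤j⇒0≤j-i lower) (ℤ.i≤j⇒0≤j-i O≤jt)) (ring₂ (+ j) s t U O (+ triangular j)) ⟩
          s + U - O + (+ j + + triangular j) * t
            ≡⟨ cong (λ i → i + (+ j + + triangular j) * t) cardinality ⟨
          card (any-of (closedNbhd x) (y ∷ ys)) + + triangular (suc j) * t ∎
      }
      where
      open Stage stage
      open ℤ.≤-Reasoning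
      next = uncovered ys (ℤ.≤-<-trans upper js<k)
      y  = proj₁ next
      xy = proj₁ (proj₂ next)
      meet : Vertex → Bool
      meet z = closedNbhd x y z ∧ any-of (closedNbhd x) ys z
      U O : ℤ
      U = card (any-of (closedNbhd x) ys)
      O = card meet
      cardinality : card (any-of (closedNbhd x) (y ∷ ys)) ≡ s + U - O
      cardinality = trans (card-∨ (closedNbhd x y) (any-of (closedNbhd x) ys))
        (cong (λ i → i + U - O) (card-closedNbhd xy))
      apart : ∀ y′ → ¬ T (closedNbhd x y′ y) → ¬ y ≡ y′ × ¬ T (adj y y′)
      apart y′ h with adj x y in x~y | y′ Fin.≟ y
      ... | true  | yes _   = ⊥-elim (h tt)
      ... | true  | no y′≢y = (λ eq → y′≢y (sym eq)) , λ yy′ → h (adj-sym yy′)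
      ... | false | _       = ⊥-elim (subst T x~y xy)
      overlaps : ∀ {ys} → All (λ y → T (adj x y)) ys → All (λ y′ → ¬ T (closedNbhd x y′ y)) ys →
                 All (λ y′ → card (λ z → closedNbhd x y z ∧ closedNbhd x y′ z) ≤ t) ys
      overlaps []         []       = []
      overlaps (xy′ ∷ p) (h ∷ hs) =
        closedNbhd-overlap xy xy′ (proj₁ (apart _ h)) (proj₂ (apart _ h)) ∷ overlaps p hs
      O≤jt : O ≤ + j * t
      O≤jt = subst (λ m → O ≤ + m * t) size (card-any-of-∧ (closedNbhd x) t (closedNbhd x y)
        (overlaps adjacent (¬any-of (closedNbhd x) ys y (proj₂ (proj₂ next)))))
      ring₁ : ∀ j s U O → (1ℤ + j) * s - (s + U - O) ≡ O + (j * s - U)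
      ring₁ = solve-∀
      ring₂ : ∀ j s t U O tr → s + U - O + (j + tr) * t - (1ℤ + j) * s ≡ (U + tr * t - j * s) + (j * t - O)
      ring₂ = solve-∀

    stage : ∀ j → (∀ i → i ℕ.< j → + i * s < + k) → Stage j
    stage zero    _ = record
      { ys = [] ; size = refl ; adjacent = []
      ; upper = ℤ.≤-reflexive (sum-0 {order} (λ _ → refl))
      ; lower = ℤ.≤-reflexive (sym (cong₂ _+_ (sum-0 {order} (λ _ → refl)) refl)) }
    stage (suc j) h = extend (h j ℕ.≤-refl) (stage j (λ i i<j → h i (ℕ.m≤n⇒m≤1+n i<j)))

    coclique-bound : ∀ j → (∀ i → i ℕ.< j → + i * s < + k) → + j * s ≤ + k + + triangular j * t
    coclique-bound j h = ℤ.≤-trans lower (ℤ.+-monoˡ-≤ (+ triangular j * t)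
      (subst (card (any-of (closedNbhd x) ys) ≤_) (∑A≡k x) (card-mono (any-of-⇒ (closedNbhd x) (adj x) closedNbhd⇒adj ys))))
      where open Stage (stage j h)

-- A bound for the order that is linear in θ

*-mono-≤ʳ : ∀ {i j k} → 0ℤ ≤ k → i ≤ j → i * k ≤ j * k
*-mono-≤ʳ {k = k} 0≤k = ℤ.*-monoʳ-≤-nonNeg k {{nonNegative 0≤k}}

0<i*j : ∀ {i j} → 0ℤ < i → 0ℤ < j → 0ℤ < i * j
0<i*j {i} {j} 0<i 0<j = subst (_< i * j) (ℤ.*-zeroʳ i) (ℤ.*-monoˡ-<-pos i {{ℤ.positive 0<i}} 0<j)

-- A bound for (θ + 1) / c₂.
T₂ : ℤ → ℤ
T₂ β = + triangular (suc ℤ.∣ β ∣) + β * β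

-- A bound for the order divided by θ.
K : ℤ → ℤ
K β = 1ℤ + β + + 3 * (β * (β - 1ℤ) * T₂ β)

module OrderBound (Γ : Graph) (isDR : IsDistanceRegular Γ 3)
  (k≡θβ : + IsDistanceRegular.k isDR ≡ Eigenmatrix.θ Γ isDR * Eigenmatrix.β Γ isDR)
  (2≤β : + 2 ≤ Eigenmatrix.β Γ isDR) where
  open Graph Γ
  open IsDistanceRegular isDR
  open ShillaGraph Γ isDR k≡θβ 2≤β public
  open Coclique Γ isDR using (closedNbhd; card-closedNbhd; module Greedy)
  open Greedy x₀ using (s; t; coclique-bound)

  m : ℕ
  m = ℤ.∣ β ∣

  β≡m : β ≡ + m
  β≡m = sym (ℤ.0≤i⇒+∣i∣≡i 0≤β)

  s≡ : s ≡ 1ℤ + (θ - β)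
  s≡ = cong (λ a → 1ℤ + a) a₁≡

  -- As the size of an actual closed neighbourhood, s is nonnegative without a separate proof of β ≤
  -- θ + 1.
  0≤s : 0ℤ ≤ s
  0≤s = subst (0ℤ ≤_) (card-closedNbhd x₀~y₁) (card-nonNeg (closedNbhd x₀ y₁))

  0<β : 0ℤ < β
  0<β = ℤ.<-≤-trans (+<+ (s≤s z≤n)) 2≤β

  -- Since k - β s = β (β - 1) > 0, even β closed neighbourhoods fail to cover the neighbourhood,
  -- and the coclique reaches size β + 1.
  extendable : ∀ i → i ℕ.< suc m → + i * s < + k
  extendable i (s≤s i≤m) = ℤ.≤-<-trans
    (*-mono-≤ʳ {+ i} {β} {s} 0≤s (subst (+ i ≤_) (sym β≡m) (+≤+ i≤m)))
    (subst₂ _<_ (ℤ.+-identityʳ (β * s)) (trans (cong (λ s → β * s + β * (β - 1ℤ)) s≡) (trans (ring θ β) (sym k≡θβ)))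
      (ℤ.+-monoʳ-< (β * s) (0<i*j 0<β 0<β-1)))
    where
    ring : ∀ θ β → β * (1ℤ + (θ - β)) + β * (β - 1ℤ) ≡ θ * β
    ring = solve-∀

  -- With β + 1 closed neighbourhoods, (β + 1) s exceeds k = θ β by θ + 1 - β², and the overlaps
  -- have to make up for this excess.
  θ+1≤T₂c₂ : θ + 1ℤ ≤ T₂ β * c₂
  θ+1≤T₂c₂ = ≤-from-difference
    ((θ * β + τ * (c₂ - 1ℤ) - (1ℤ + β) * (1ℤ + (θ - β))) + (τ + β * β * (c₂ - 1ℤ)))
    (0≤i+j (ℤ.i≤j⇒0≤j-i bound) (0≤i+j {τ} (+≤+ z≤n) (0≤i*j (0≤i*i β) (ℤ.i≤j⇒0≤j-i 1≤c₂))))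
    (ring θ β c₂ τ)
    where
    τ = + triangular (suc m)
    bound : (1ℤ + β) * (1ℤ + (θ - β)) ≤ θ * β + τ * (c₂ - 1ℤ)
    bound = subst₂ _≤_ (cong₂ (λ i j → (1ℤ + i) * j) (sym β≡m) s≡) (cong (λ k → k + τ * (c₂ - 1ℤ)) k≡θβ)
      (coclique-bound (suc m) extendable)
    ring : ∀ θ β c₂ τ → (τ + β * β) * c₂ - (θ + 1ℤ) ≡
      (θ * β + τ * (c₂ - 1ℤ) - (1ℤ + β) * (1ℤ + (θ - β))) + (τ + β * β * (c₂ - 1ℤ))
    ring = solve-∀

  one : Vertex → ℤ
  one _ = 1ℤ

  n₂ n₃ : ℤ
  n₂ = F 2 one x₀
  n₃ = F 3 one x₀

  0≤n₂ : 0ℤ ≤ n₂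
  0≤n₂ = sum-nonNeg (λ z → 0≤i*j (⟦⟧-nonNeg (does (d x₀ z ℕ.≟ 2))) (+≤+ z≤n))

  order≡ : + order ≡ 1ℤ + θ * β + n₂ + n₃
  order≡ = begin
    + order                                        ≡⟨ ℤ.*-identityʳ (+ order) ⟨
    + order * 1ℤ                                   ≡⟨ sum-const order 1ℤ ⟨
    ∑[ z < order ] (1ℤ * one z)                    ≡⟨ radial-sum (λ _ → 1ℤ) one x₀ ⟩
    1ℤ * F 0 one x₀ + 1ℤ * F 1 one x₀ + 1ℤ * n₂ + 1ℤ * n₃
      ≡⟨ cong₂ (λ p q → 1ℤ * p + 1ℤ * q + 1ℤ * n₂ + 1ℤ * n₃) (F₀ one x₀)
           (trans (F₁ one (+ k) constant-isEigenfunction x₀) (cong (_* 1ℤ) k≡θβ)) ⟩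
    1ℤ * 1ℤ + 1ℤ * (θ * β * 1ℤ) + 1ℤ * n₂ + 1ℤ * n₃  ≡⟨ ring (θ * β) n₂ n₃ ⟩
    1ℤ + θ * β + n₂ + n₃                           ∎
    where
    open ≡-Reasoning
    ring : ∀ k p q → 1ℤ * 1ℤ + 1ℤ * (k * 1ℤ) + 1ℤ * p + 1ℤ * q ≡ 1ℤ + k + p + q
    ring = solve-∀

  c₂n₂≡ : c₂ * n₂ ≡ θ * β * (β - 1ℤ) * (θ + 1ℤ)
  c₂n₂≡ = begin
    c₂ * n₂                                  ≡⟨ F₂ one (+ k) constant-isEigenfunction x₀ ⟩
    (+ k * + k - a 1F * + k - + k) * 1ℤ       ≡⟨ cong₂ (λ k a → (k * k - a * k - k) * 1ℤ) k≡θβ a₁≡ ⟩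
    (θ * β * (θ * β) - (θ - β) * (θ * β) - θ * β) * 1ℤ  ≡⟨ ring θ β ⟩
    θ * β * (β - 1ℤ) * (θ + 1ℤ)              ∎
    where
    open ≡-Reasoning
    ring : ∀ θ β → (θ * β * (θ * β) - (θ - β) * (θ * β) - θ * β) * 1ℤ ≡ θ * β * (β - 1ℤ) * (θ + 1ℤ)
    ring = solve-∀

  c₃n₃≡ : + c 3F * n₃ ≡ b₂ * n₂
  c₃n₃≡ = begin
    + c 3F * n₃
      ≡⟨ F₃ one (+ k) constant-isEigenfunction x₀ ⟩
    (+ k - a 2F) * n₂ - + b 1F * (+ k * 1ℤ)
      ≡⟨ ring₁ (+ k) b₂ c₂ n₂ (+ b 1F) ⟩
    b₂ * n₂ + (c₂ * n₂ - + b 1F * + k)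
      ≡⟨ cong (λ i → b₂ * n₂ + i) (trans (cong₂ _-_ c₂n₂≡ (cong₂ _*_ b₁≡ k≡θβ)) (ring₂ θ β)) ⟩
    b₂ * n₂ + 0ℤ
      ≡⟨ ℤ.+-identityʳ (b₂ * n₂) ⟩
    b₂ * n₂ ∎
    where
    open ≡-Reasoning
    ring₁ : ∀ k b c n b₁ → (k - (k - b - c)) * n - b₁ * (k * 1ℤ) ≡ b * n + (c * n - b₁ * k)
    ring₁ = solve-∀
    ring₂ : ∀ θ β → θ * β * (β - 1ℤ) * (θ + 1ℤ) - (θ + 1ℤ) * (β - 1ℤ) * (θ * β) ≡ 0ℤ
    ring₂ = solve-∀

  b₂≤k : b₂ ≤ + k
  b₂≤k = subst₂ _≤_ (trans (count-b x₀ y₂) (cong (λ i → + b i) (dist-unique 2F x₀y₂))) (∑A≡k y₂)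
    (sum-mono-≤ (λ z → at-most (adj y₂ z) (does (d x₀ z ℕ.≟ suc (d x₀ y₂)))))
    where
    at-most : ∀ b c → ⟦ b ⟧ * ⟦ c ⟧ ≤ ⟦ b ⟧
    at-most true  true  = ℤ.≤-refl
    at-most true  false = +≤+ z≤n
    at-most false c     = ℤ.≤-refl

  -- From n₃ / n₂ = b₂ / c₃, b₂ ≤ k and k / c₃ = β / (β - 1) ≤ 2.
  n₃≤2n₂ : n₃ ≤ + 2 * n₂
  n₃≤2n₂ = *-cancelˡ-≤ (0<i*j 0<θ 0<β-1) (begin
    θ * (β - 1ℤ) * n₃              ≡⟨ cong (_* n₃) c₃≡ ⟨
    + c 3F * n₃                    ≡⟨ c₃n₃≡ ⟩
    b₂ * n₂                        ≤⟨ *-mono-≤ʳ {b₂} {+ k} 0≤n₂ b₂≤k ⟩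
    + k * n₂                       ≡⟨ cong (_* n₂) k≡θβ ⟩
    θ * β * n₂                     ≤⟨ ≤-from-difference (θ * (β - + 2) * n₂)
                                        (0≤i*j (0≤i*j 0≤θ (ℤ.i≤j⇒0≤j-i 2≤β)) 0≤n₂) (ring θ β n₂) ⟩
    θ * (β - 1ℤ) * (+ 2 * n₂)      ∎)
    where
    open ℤ.≤-Reasoning
    ring : ∀ θ β n → θ * (β - 1ℤ) * (+ 2 * n) - θ * β * n ≡ θ * (β - + 2) * n
    ring = solve-∀

  -- The size k b₁ / c₂ is quadratic in θ apart from c₂; the bound for (θ + 1) / c₂ removes one of
  -- the two factors.
  n₂≤ : n₂ ≤ θ * (β * (β - 1ℤ) * T₂ β)
  n₂≤ = *-cancelˡ-≤ 0<c₂ (begin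
    c₂ * n₂                            ≡⟨ c₂n₂≡ ⟩
    θ * β * (β - 1ℤ) * (θ + 1ℤ)        ≤⟨ *-monoˡ-≤ (0≤i*j (0≤i*j 0≤θ 0≤β) (ℤ.<⇒≤ 0<β-1)) θ+1≤T₂c₂ ⟩
    θ * β * (β - 1ℤ) * (T₂ β * c₂)     ≡⟨ ring θ β (T₂ β) c₂ ⟩
    c₂ * (θ * (β * (β - 1ℤ) * T₂ β))   ∎)
    where
    open ℤ.≤-Reasoning
    ring : ∀ θ β T c → θ * β * (β - 1ℤ) * (T * c) ≡ c * (θ * (β * (β - 1ℤ) * T))
    ring = solve-∀

  order≤θK : + order ≤ θ * K β
  order≤θK = begin
    + order                          ≡⟨ order≡ ⟩
    1ℤ + θ * β + n₂ + n₃
      ≤⟨ ≤-from-difference ((θ - 1ℤ) + (+ 3 * (θ * P - n₂) + (+ 2 * n₂ - n₃)))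
           (0≤i+j (ℤ.i≤j⇒0≤j-i (ℤ.i<j⇒suc[i]≤j 0<θ)) (0≤i+j (0≤i*j {+ 3} (+≤+ z≤n) (ℤ.i≤j⇒0≤j-i n₂≤)) (ℤ.i≤j⇒0≤j-i n₃≤2n₂)))
           (ring θ β P n₂ n₃) ⟩
    θ * K β ∎
    where
    open ℤ.≤-Reasoning
    P = β * (β - 1ℤ) * T₂ β
    ring : ∀ θ β P n₂ n₃ → θ * (1ℤ + β + + 3 * P) - (1ℤ + θ * β + n₂ + n₃) ≡
      (θ - 1ℤ) + (+ 3 * (θ * P - n₂) + (+ 2 * n₂ - n₃))
    ring = solve-∀

-- Many orthogonal differences

∙-comm : ∀ {n} (f g : Vector ℤ n) → f ∙ g ≡ g ∙ f
∙-comm f g = sum-cong-≗ (λ i → ℤ.*-comm (f i) (g i))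

∙-linear : ∀ {n} (f : Vector ℤ n) c g d h → f ∙ (λ i → c * g i + d * h i) ≡ c * f ∙ g + d * f ∙ h
∙-linear {n} f c g d h = begin
  f ∙ (λ i → c * g i + d * h i)
    ≡⟨ sum-cong-≗ (λ i → ring (f i) c (g i) d (h i)) ⟩
  ∑[ i < n ] (c * (f i * g i) + d * (f i * h i))
    ≡⟨ ∑-distrib-+ (λ i → c * (f i * g i)) (λ i → d * (f i * h i)) ⟩
  ∑[ i < n ] (c * (f i * g i)) + ∑[ i < n ] (d * (f i * h i))
    ≡⟨ cong₂ _+_ (*-distribˡ-sum c (λ i → f i * g i)) (*-distribˡ-sum d (λ i → f i * h i)) ⟨
  c * f ∙ g + d * f ∙ h ∎
  where
  open ≡-Reasoning
  ring : ∀ f c g d h → f * (c * g + d * h) ≡ c * (f * g) + d * (f * h)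
  ring = solve-∀

∙-square : ∀ {n} c (g : Vector ℤ n) d h →
           let f = λ i → c * g i + d * h i in
           f ∙ f ≡ c * c * g ∙ g + + 2 * (c * d * g ∙ h) + d * d * h ∙ h
∙-square c g d h = begin
  f ∙ f
    ≡⟨ ∙-linear f c g d h ⟩
  c * f ∙ g + d * f ∙ h
    ≡⟨ cong₂ (λ s t → c * s + d * t) (trans (∙-comm f g) (∙-linear g c g d h)) (trans (∙-comm f h) (∙-linear h c g d h)) ⟩
  c * (c * g ∙ g + d * g ∙ h) + d * (c * h ∙ g + d * h ∙ h)
    ≡⟨ cong (λ s → c * (c * g ∙ g + d * g ∙ h) + d * (c * s + d * h ∙ h)) (∙-comm h g) ⟩
  c * (c * g ∙ g + d * g ∙ h) + d * (c * g ∙ h + d * h ∙ h)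
    ≡⟨ ring c d (g ∙ g) (g ∙ h) (h ∙ h) ⟩
  c * c * g ∙ g + + 2 * (c * d * g ∙ h) + d * d * h ∙ h ∎
  where
  open ≡-Reasoning
  f = λ i → c * g i + d * h i
  ring : ∀ c d p q r → c * (c * p + d * q) + d * (c * q + d * r) ≡ c * c * p + + 2 * (c * d * q) + d * d * r
  ring = solve-∀

0≤∙ : ∀ {n} (f : Vector ℤ n) → 0ℤ ≤ f ∙ f
0≤∙ f = sum-nonNeg (λ i → 0≤i*i (f i))

module Bessel {n} (v : Vector ℤ n) where
  squares : List (Vector ℤ n) → ℤ
  squares []       = 0ℤ
  squares (h ∷ hs) = v ∙ h * v ∙ h + squares hs

  -- Without the usual division by h · h, so as to stay in the integers; a common upper bound t of
  -- the norms takes the place of the divisors. The coefficient 1 gives the sum the shape expected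
  -- by `∙-linear` and `∙-square`.
  projection : List (Vector ℤ n) → Vector ℤ n
  projection []       i = 0ℤ
  projection (h ∷ hs) i = v ∙ h * h i + 1ℤ * projection hs i

  v∙projection : ∀ hs → v ∙ projection hs ≡ squares hs
  v∙projection []       = sum-0 {n} (λ i → ℤ.*-zeroʳ (v i))
  v∙projection (h ∷ hs) = trans (∙-linear v (v ∙ h) h 1ℤ (projection hs))
    (cong (λ s → v ∙ h * v ∙ h + s) (trans (ℤ.*-identityˡ _) (v∙projection hs)))

  orthogonal-projection : ∀ f {hs} → All (λ h → f ∙ h ≡ 0ℤ) hs → f ∙ projection hs ≡ 0ℤ
  orthogonal-projection f []                    = sum-0 {n} (λ i → ℤ.*-zeroʳ (f i))
  orthogonal-projection f {h ∷ hs} (f⊥h ∷ f⊥hs) = trans (∙-linear f (v ∙ h) h 1ℤ (projection hs))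
    (trans (cong₂ (λ s t → v ∙ h * s + 1ℤ * t) f⊥h (orthogonal-projection f f⊥hs)) (ring (v ∙ h)))
    where
    ring : ∀ c → c * 0ℤ + 1ℤ * 0ℤ ≡ 0ℤ
    ring = solve-∀

  projection∙projection : ∀ t {hs} → All (λ h → h ∙ h ≤ t) hs → AllPairs (λ f h → f ∙ h ≡ 0ℤ) hs →
                          projection hs ∙ projection hs ≤ t * squares hs
  projection∙projection t []                   []           =
    ℤ.≤-reflexive (trans (sum-0 {n} (λ i → refl)) (sym (ℤ.*-zeroʳ t)))
  projection∙projection t {h ∷ hs} (h≤t ∷ hs≤t) (h⊥hs ∷ ⊥hs) = begin
    projection (h ∷ hs) ∙ projection (h ∷ hs)
      ≡⟨ ∙-square c h 1ℤ p ⟩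
    c * c * h ∙ h + + 2 * (c * 1ℤ * h ∙ p) + 1ℤ * 1ℤ * p ∙ p
      ≡⟨ cong (λ s → c * c * h ∙ h + + 2 * (c * 1ℤ * s) + 1ℤ * 1ℤ * p ∙ p) (orthogonal-projection h h⊥hs) ⟩
    c * c * h ∙ h + + 2 * (c * 1ℤ * 0ℤ) + 1ℤ * 1ℤ * p ∙ p
      ≤⟨ ≤-from-difference (c * c * (t - h ∙ h) + (t * squares hs - p ∙ p))
           (0≤i+j (0≤i*j (0≤i*i c) (ℤ.i≤j⇒0≤j-i h≤t)) (ℤ.i≤j⇒0≤j-i (projection∙projection t hs≤t ⊥hs)))
           (ring c t (h ∙ h) (p ∙ p) (squares hs)) ⟩
    t * squares (h ∷ hs) ∎
    where
    open ℤ.≤-Reasoning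
    c = v ∙ h
    p = projection hs
    ring : ∀ c t hh pp sq → t * (c * c + sq) - (c * c * hh + + 2 * (c * 1ℤ * 0ℤ) + 1ℤ * 1ℤ * pp) ≡
           c * c * (t - hh) + (t * sq - pp)
    ring = solve-∀

  -- Let p be the unnormalised projection. Expand 0 ≤ |t v - p|², where v · p is the sum of squares
  -- and p · p is at most t times it, and cancel t.
  bessel : ∀ {t hs} → 0ℤ < t → All (λ h → h ∙ h ≤ t) hs → AllPairs (λ f h → f ∙ h ≡ 0ℤ) hs →
           squares hs ≤ t * v ∙ v
  bessel {t} {hs} 0<t hs≤t ⊥hs = *-cancelˡ-≤ 0<t (≤-from-difference
    ((t * t * v ∙ v + + 2 * (t * - 1ℤ * v ∙ p) + - 1ℤ * - 1ℤ * p ∙ p) + (t * squares hs - p ∙ p))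
    (0≤i+j (subst (0ℤ ≤_) (∙-square t v (- 1ℤ) p) (0≤∙ (λ i → t * v i + - 1ℤ * p i)))
      (ℤ.i≤j⇒0≤j-i (projection∙projection t hs≤t ⊥hs)))
    (trans (ring t (v ∙ v) (squares hs) (p ∙ p))
      (cong (λ s → (t * t * v ∙ v + + 2 * (t * - 1ℤ * s) + - 1ℤ * - 1ℤ * p ∙ p) + (t * squares hs - p ∙ p))
        (sym (v∙projection hs)))))
    where
    p = projection hs
    ring : ∀ t vv sq pp → t * (t * vv) - t * sq ≡ (t * t * vv + + 2 * (t * - 1ℤ * sq) + - 1ℤ * - 1ℤ * pp) + (t * sq - pp)
    ring = solve-∀


open Bessel using (squares; bessel)

-- Selecting indistinguishable pairs

module Pigeonhole {A : Set} (f : A → Fin 4) where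
  fibre : Fin 4 → List A → List A
  fibre i = filter (λ x → f x Fin.≟ i)

  fibres-length : ∀ xs → length xs ≡ length (fibre 0F xs) ℕ.+ length (fibre 1F xs)
                                     ℕ.+ length (fibre 2F xs) ℕ.+ length (fibre 3F xs)
  fibres-length []       = refl
  fibres-length (x ∷ xs) with f x | fibres-length xs
  ... | 0F | eq = cong suc eq
  ... | 1F | eq rewrite ℕ.+-suc (length (fibre 0F xs)) (length (fibre 1F xs)) = cong suc eq
  ... | 2F | eq rewrite ℕ.+-suc (length (fibre 0F xs) ℕ.+ length (fibre 1F xs)) (length (fibre 2F xs)) = cong suc eq
  ... | 3F | eq rewrite ℕ.+-suc (length (fibre 0F xs) ℕ.+ length (fibre 1F xs) ℕ.+ length (fibre 2F xs))
                                (length (fibre 3F xs)) = cong suc eq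

  large-fibre : ∀ m xs → 4 ℕ.* m ℕ.≤ length xs → ∃ λ i → m ℕ.≤ length (fibre i xs)
  large-fibre m xs 4m≤ with Fin.any? (λ i → m ℕ.≤? length (fibre i xs))
  ... | yes found = found
  ... | no  none  = contradiction 4m≤ (ℕ.<⇒≱ (begin-strict
    length xs
      ≡⟨ fibres-length xs ⟩
    length (fibre 0F xs) ℕ.+ length (fibre 1F xs) ℕ.+ length (fibre 2F xs) ℕ.+ length (fibre 3F xs)
      <⟨ ℕ.+-mono-< (ℕ.+-mono-< (ℕ.+-mono-< (small 0F) (small 1F)) (small 2F)) (small 3F) ⟩
    m ℕ.+ m ℕ.+ m ℕ.+ m
      ≡⟨ four m ⟩
    4 ℕ.* m ∎))
    where
    open ℕ.≤-Reasoning
    small : ∀ i → length (fibre i xs) ℕ.< m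
    small i = ℕ.≰⇒> (λ m≤ → none (i , m≤))
    four : ∀ m → m ℕ.+ m ℕ.+ m ℕ.+ m ≡ 4 ℕ.* m
    four m = trans (ℕ.+-assoc (m ℕ.+ m) m m) (trans (ℕ.+-assoc m m (m ℕ.+ m))
      (cong (λ s → m ℕ.+ (m ℕ.+ (m ℕ.+ s))) (sym (ℕ.+-identityʳ m))))

-- Each pair costs its two vertices and two restrictions to a largest of four colour classes.
ramsey : ℕ → ℕ
ramsey zero    = 0
ramsey (suc r) = 2 ℕ.+ 4 ℕ.* (4 ℕ.* ramsey r)

module Selection {A : Set} (colour : A → A → Fin 4) where
  open Pigeonhole

  -- The earlier pair does not tell the two later vertices apart. The condition is one-sided, and
  -- this already makes the inner product of the two differences vanish.
  Indistinguishable : A × A → A × A → Set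
  Indistinguishable (x , y) (x′ , y′) = colour x x′ ≡ colour x y′ × colour y x′ ≡ colour y y′

  record Selected (r : ℕ) (xs : List A) : Set where
    field
      pairs             : List (A × A)
      size              : length pairs ≡ r
      members           : All (λ p → proj₁ p ∈ xs × proj₂ p ∈ xs) pairs
      distinct          : All (λ p → ¬ proj₁ p ≡ proj₂ p) pairs
      indistinguishable : AllPairs Indistinguishable pairs

  -- All later pairs come from a set on which the colours relative to x and to y are both constant,
  -- so (x , y) distinguishes the members of none of them.
  select : ∀ r xs → Unique xs → ramsey r ℕ.≤ length xs → Selected r xs
  select zero    xs _ _ = record { pairs = [] ; size = refl ; members = [] ; distinct = [] ; indistinguishable = [] }
  select (suc r) (x ∷ [])     _ (s≤s ())
  select (suc r) (x ∷ y ∷ xs) ((x≢y ∷ _) ∷ _ ∷ unique) (s≤s (s≤s le)) = record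
    { pairs             = (x , y) ∷ pairs
    ; size              = cong suc size
    ; members           = (here refl , there (here refl)) ∷
                          All.map (λ (p , q) → there (there (unfilter p)) , there (there (unfilter q))) members
    ; distinct          = x≢y ∷ distinct
    ; indistinguishable = All.map (λ (p , q) → trans (colour-x p) (sym (colour-x q)) , trans (colour-y p) (sym (colour-y q)))
                            members ∷ indistinguishable
    }
    where
    by-x = large-fibre (colour x) (4 ℕ.* ramsey r) xs le
    i = proj₁ by-x
    xs₁ = fibre (colour x) i xs
    by-y = large-fibre (colour y) (ramsey r) xs₁ (proj₂ by-x)
    j = proj₁ by-y
    xs₂ = fibre (colour y) j xs₁
    open Selected (select r xs₂ (Unique.filter⁺ (λ u → colour y u Fin.≟ j) (Unique.filter⁺ (λ u → colour x u Fin.≟ i) unique)) (proj₂ by-y))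
    un₂ : ∀ {u} → u ∈ xs₂ → u ∈ xs₁ × colour y u ≡ j
    un₂ = ∈-filter⁻ (λ u → colour y u Fin.≟ j) {xs = xs₁}
    un₁ : ∀ {u} → u ∈ xs₁ → u ∈ xs × colour x u ≡ i
    un₁ = ∈-filter⁻ (λ u → colour x u Fin.≟ i) {xs = xs}
    unfilter : ∀ {u} → u ∈ xs₂ → u ∈ xs
    unfilter u = proj₁ (un₁ (proj₁ (un₂ u)))
    colour-x : ∀ {u} → u ∈ xs₂ → colour x u ≡ i
    colour-x u = proj₂ (un₁ (proj₁ (un₂ u)))
    colour-y : ∀ {u} → u ∈ xs₂ → colour y u ≡ j
    colour-y u = proj₂ (un₂ u)

-- Bounding the number of selected pairs

module SpreadPairs (Γ : Graph) (isDR : IsDistanceRegular Γ 3)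
  (k≡θβ : + IsDistanceRegular.k isDR ≡ Eigenmatrix.θ Γ isDR * Eigenmatrix.β Γ isDR)
  (2≤β : + 2 ≤ Eigenmatrix.β Γ isDR) where
  open Graph Γ
  open IsDistanceRegular isDR
  open OrderBound Γ isDR k≡θβ 2≤β public
  open Selection dist using (Indistinguishable; Selected; select)

  -- W applied to the difference of the unit vectors of x and y.
  D : Vertex × Vertex → Vertex → ℤ
  D (x , y) u = 1ℤ * W x u + - 1ℤ * W y u

  W∙D : ∀ z p → W z ∙ D p ≡ S * D p z
  W∙D z (x , y) = begin
    W z ∙ D (x , y)                                ≡⟨ ∙-linear (W z) 1ℤ (W x) (- 1ℤ) (W y) ⟩
    1ℤ * W z ∙ W x + - 1ℤ * W z ∙ W y              ≡⟨ cong₂ (λ p q → 1ℤ * p + - 1ℤ * q) (W∙W z x) (W∙W z y) ⟩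
    1ℤ * (S * W z x) + - 1ℤ * (S * W z y)          ≡⟨ cong₂ (λ p q → 1ℤ * (S * p) + - 1ℤ * (S * q)) (W-sym z x) (W-sym z y) ⟩
    1ℤ * (S * W x z) + - 1ℤ * (S * W y z)          ≡⟨ ring S (W x z) (W y z) ⟩
    S * D (x , y) z                                ∎
    where
    open ≡-Reasoning
    ring : ∀ S p q → 1ℤ * (S * p) + - 1ℤ * (S * q) ≡ S * (1ℤ * p + - 1ℤ * q)
    ring = solve-∀

  D∙D : ∀ p x y → D p ∙ D (x , y) ≡ S * (D p x - D p y)
  D∙D p x y = begin
    D p ∙ D (x , y)
      ≡⟨ ∙-linear (D p) 1ℤ (W x) (- 1ℤ) (W y) ⟩
    1ℤ * D p ∙ W x + - 1ℤ * D p ∙ W y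
      ≡⟨ cong₂ (λ s t → 1ℤ * s + - 1ℤ * t) (trans (∙-comm (D p) (W x)) (W∙D x p)) (trans (∙-comm (D p) (W y)) (W∙D y p)) ⟩
    1ℤ * (S * D p x) + - 1ℤ * (S * D p y)
      ≡⟨ ring S (D p x) (D p y) ⟩
    S * (D p x - D p y) ∎
    where
    open ≡-Reasoning
    ring : ∀ S p q → 1ℤ * (S * p) + - 1ℤ * (S * q) ≡ S * (p - q)
    ring = solve-∀

  -- The inner product is S (W x x′ - W y x′ - W x y′ + W y y′). Entries of W depend only on the
  -- distance, so the terms with x cancel, and so do those with y.
  indistinguishable⇒⊥ : ∀ p q → Indistinguishable p q → D p ∙ D q ≡ 0ℤ
  indistinguishable⇒⊥ (x , y) (x′ , y′) (eq , eq′) = begin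
    D (x , y) ∙ D (x′ , y′)
      ≡⟨ D∙D (x , y) x′ y′ ⟩
    S * (D (x , y) x′ - D (x , y) y′)
      ≡⟨ cong₂ (λ i j → S * (1ℤ * w (toℕ i) + - 1ℤ * w (toℕ j) - D (x , y) y′)) eq eq′ ⟩
    S * (D (x , y) y′ - D (x , y) y′)
      ≡⟨ cong (S *_) (ℤ.+-inverseʳ (D (x , y) y′)) ⟩
    S * 0ℤ
      ≡⟨ ℤ.*-zeroʳ S ⟩
    0ℤ ∎
    where open ≡-Reasoning

  W-diagonal : ∀ x → W x x ≡ β * b₂
  W-diagonal x = cong w (d-refl x)

  D-norm : ∀ x y → D (x , y) ∙ D (x , y) ≡ S * (+ 2 * (β * b₂ - W x y))
  D-norm x y = begin
    D (x , y) ∙ D (x , y)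
      ≡⟨ D∙D (x , y) x y ⟩
    S * ((1ℤ * W x x + - 1ℤ * W y x) - (1ℤ * W x y + - 1ℤ * W y y))
      ≡⟨ cong₂ (λ p q → S * ((1ℤ * p + - 1ℤ * W y x) - (1ℤ * W x y + - 1ℤ * q))) (W-diagonal x) (W-diagonal y) ⟩
    S * ((1ℤ * (β * b₂) + - 1ℤ * W y x) - (1ℤ * W x y + - 1ℤ * (β * b₂)))
      ≡⟨ cong (λ p → S * ((1ℤ * (β * b₂) + - 1ℤ * p) - (1ℤ * W x y + - 1ℤ * (β * b₂)))) (W-sym y x) ⟩
    S * ((1ℤ * (β * b₂) + - 1ℤ * W x y) - (1ℤ * W x y + - 1ℤ * (β * b₂)))
      ≡⟨ ring S (β * b₂) (W x y) ⟩
    S * (+ 2 * (β * b₂ - W x y)) ∎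
    where
    open ≡-Reasoning
    ring : ∀ S p q → S * ((1ℤ * p + - 1ℤ * q) - (1ℤ * q + - 1ℤ * p)) ≡ S * (+ 2 * (p - q))
    ring = solve-∀

  -c₂≤0 : - c₂ ≤ 0ℤ
  -c₂≤0 = ℤ.neg-mono-≤ (ℤ.<⇒≤ 0<c₂)

  0≤βb₂ : 0ℤ ≤ β * b₂
  0≤βb₂ = 0≤i*j 0≤β (ℤ.<⇒≤ 0<b₂)

  -c₂≤W : ∀ x y → - c₂ ≤ W x y
  -c₂≤W x y = go (dist x y)
    where
    go : ∀ i → - c₂ ≤ w (toℕ i)
    go 0F = ℤ.≤-trans -c₂≤0 0≤βb₂
    go 1F = ℤ.≤-trans -c₂≤0 (ℤ.<⇒≤ 0<b₂)
    go 2F = -c₂≤0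
    go 3F = ℤ.≤-refl

  W≤b₂ : ∀ {x y} → ¬ x ≡ y → W x y ≤ b₂
  W≤b₂ {x} {y} x≢y = go (dist x y) (λ d≡0 → x≢y (d≡0⇒≡ d≡0))
    where
    go : ∀ i → ¬ toℕ i ≡ 0 → w (toℕ i) ≤ b₂
    go 0F h = contradiction refl h
    go 1F h = ℤ.≤-refl
    go 2F h = ℤ.<⇒≤ 0<b₂
    go 3F h = ℤ.≤-trans -c₂≤0 (ℤ.<⇒≤ 0<b₂)

  0<S : 0ℤ < S
  0<S = ℤ.+-mono-<-≤ {0ℤ} {b₂ * (β + θ)} {0ℤ} (0<i*j 0<b₂ (ℤ.+-mono-<-≤ {0ℤ} {β} {0ℤ} 0<β 0≤θ))
    (0≤i*j (ℤ.<⇒≤ 0<c₂) (0≤i+j 0≤θ (+≤+ z≤n)))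

  0≤S : 0ℤ ≤ S
  0≤S = ℤ.<⇒≤ 0<S

  N : ℤ
  N = + 2 * (β * b₂ + c₂)

  D-norm≤ : ∀ p → D p ∙ D p ≤ S * N
  D-norm≤ (x , y) = subst (_≤ S * N) (sym (D-norm x y)) (*-monoˡ-≤ 0≤S
    (≤-from-difference (+ 2 * (W x y - - c₂)) (0≤i*j {+ 2} (+≤+ z≤n) (ℤ.i≤j⇒0≤j-i (-c₂≤W x y))) (ring (β * b₂) c₂ (W x y))))
    where
    ring : ∀ p c q → + 2 * (p + c) - + 2 * (p - q) ≡ + 2 * (q - - c)
    ring = solve-∀

  -- W is β b₂ on the diagonal and at most b₂ off it, which leaves a gap of (β - 1) b₂.
  ≤D-norm : ∀ {x y} → ¬ x ≡ y → S * (+ 2 * (β - 1ℤ) * b₂) ≤ D (x , y) ∙ D (x , y)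
  ≤D-norm {x} {y} x≢y = subst (S * (+ 2 * (β - 1ℤ) * b₂) ≤_) (sym (D-norm x y)) (*-monoˡ-≤ 0≤S
    (≤-from-difference (+ 2 * (b₂ - W x y)) (0≤i*j {+ 2} (+≤+ z≤n) (ℤ.i≤j⇒0≤j-i (W≤b₂ x≢y))) (ring β b₂ (W x y))))
    where
    ring : ∀ β b q → + 2 * (β * b - q) - + 2 * (β - 1ℤ) * b ≡ + 2 * (b - q)
    ring = solve-∀

  0<N : 0ℤ < N
  0<N = 0<i*j {+ 2} (+<+ (s≤s z≤n)) (ℤ.+-mono-≤-< 0≤βb₂ 0<c₂)

  -- Bessel's inequality for a row of W; all rows have the same norm S β b₂.
  squares≤ : ∀ {ps} → AllPairs Indistinguishable ps → ∀ z → squares (W z) (map D ps) ≤ S * N * (S * (β * b₂))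
  squares≤ {ps} indist z = subst (λ i → squares (W z) (map D ps) ≤ S * N * i)
    (trans (W∙W z z) (cong (S *_) (W-diagonal z)))
    (bessel (W z) (0<i*j 0<S 0<N) (All.map⁺ (All.universal (λ p → D-norm≤ p) ps))
      (AllPairs.map⁺ (AllPairs.map (λ {p} {q} → indistinguishable⇒⊥ p q) indist)))

  -- As W z · D p = S (D p z), summation over all z turns the squares into S² times the norm of D p.
  ≤∑squares : ∀ {ps} → All (λ p → ¬ proj₁ p ≡ proj₂ p) ps →
              + length ps * (S * S * (S * (+ 2 * (β - 1ℤ) * b₂))) ≤ ∑[ z < order ] squares (W z) (map D ps)
  ≤∑squares [] = sum-nonNeg {order} (λ _ → ℤ.≤-refl)
  ≤∑squares {p ∷ ps} (x≢y ∷ distinct) = begin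
    + suc (length ps) * (S * S * M)
      ≡⟨ ℤ.suc-* (+ length ps) (S * S * M) ⟩
    S * S * M + + length ps * (S * S * M)
      ≤⟨ ℤ.+-mono-≤ (*-monoˡ-≤ (0≤i*i S) (≤D-norm x≢y)) (≤∑squares distinct) ⟩
    S * S * D p ∙ D p + ∑[ z < order ] squares (W z) (map D ps)
      ≡⟨ cong (λ s → s + ∑[ z < order ] squares (W z) (map D ps)) (trans (*-distribˡ-sum (S * S) (λ z → D p z * D p z))
           (sum-cong-≗ (λ z → trans (ring S (D p z)) (cong₂ _*_ (sym (W∙D z p)) (sym (W∙D z p)))))) ⟩
    ∑[ z < order ] (W z ∙ D p * W z ∙ D p) + ∑[ z < order ] squares (W z) (map D ps)
      ≡⟨ ∑-distrib-+ (λ z → W z ∙ D p * W z ∙ D p) (λ z → squares (W z) (map D ps)) ⟨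
    ∑[ z < order ] squares (W z) (map D (p ∷ ps)) ∎
    where
    open ℤ.≤-Reasoning
    M = S * (+ 2 * (β - 1ℤ) * b₂)
    ring : ∀ S i → S * S * (i * i) ≡ S * i * (S * i)
    ring = solve-∀

  pairs-bound : ∀ {ps} → All (λ p → ¬ proj₁ p ≡ proj₂ p) ps → AllPairs Indistinguishable ps →
                + length ps ≤ K β * (β * β)
  pairs-bound {ps} distinct indist = *-cancelˡ-≤ 0<C (begin
    C * r
      -- This is θ (b₂ + c₂) ≤ S (β - 1): S exceeds θ (b₂ + c₂) by b₂ β + c₂, and β - 1 is at least
      -- 1.
      ≤⟨ ≤-from-difference (S * S * + 2 * b₂ * r * (S * (β - + 2) + (b₂ * β + c₂)))
           (0≤i*j (0≤i*j (0≤i*j (0≤i*j (0≤i*i S) (+≤+ z≤n)) 0≤b₂) (+≤+ z≤n))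
             (0≤i+j (0≤i*j 0≤S (ℤ.i≤j⇒0≤j-i 2≤β)) (0≤i+j (0≤i*j 0≤b₂ 0≤β) 0≤c₂)))
           (ring₁ b₂ c₂ θ β r) ⟩
    r * (S * S * (S * (+ 2 * (β - 1ℤ) * b₂)))
      ≤⟨ ≤∑squares distinct ⟩
    ∑[ z < order ] squares (W z) (map D ps)
      ≤⟨ sum-mono-≤ (squares≤ indist) ⟩
    ∑[ z < order ] (S * N * (S * (β * b₂)))
      ≡⟨ sum-const order (S * N * (S * (β * b₂))) ⟩
    + order * (S * N * (S * (β * b₂)))
      ≤⟨ *-mono-≤ʳ {+ order} {θ * K β} (0≤i*j (0≤i*j 0≤S (ℤ.<⇒≤ 0<N)) (0≤i*j 0≤S 0≤βb₂)) order≤θK ⟩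
    θ * K β * (S * N * (S * (β * b₂)))
      -- This is β b₂ + c₂ ≤ β (b₂ + c₂).
      ≤⟨ ≤-from-difference (S * S * + 2 * b₂ * (θ * K β) * β * (c₂ * (β - 1ℤ)))
           (0≤i*j (0≤i*j (0≤i*j (0≤i*j (0≤i*j (0≤i*i S) (+≤+ z≤n)) 0≤b₂) 0≤θK) 0≤β)
             (0≤i*j 0≤c₂ (ℤ.<⇒≤ 0<β-1)))
           (ring₂ S b₂ c₂ θ β (K β)) ⟩
    C * (K β * (β * β)) ∎)
    where
    open ℤ.≤-Reasoning
    r = + length ps
    -- The factor θ (b₂ + c₂) comes from S on the left-hand side; its θ meets the one in the bound
    -- for the order, so that cancelling C leaves a bound in β alone.
    C = S * S * + 2 * b₂ * (θ * (b₂ + c₂))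
    0≤b₂ = ℤ.<⇒≤ 0<b₂
    0≤c₂ = ℤ.<⇒≤ 0<c₂
    0≤θK : 0ℤ ≤ θ * K β
    0≤θK = ℤ.≤-trans (+≤+ z≤n) order≤θK
    0<C : 0ℤ < C
    0<C = 0<i*j (0<i*j (0<i*j (0<i*j 0<S 0<S) (+<+ (s≤s z≤n))) 0<b₂) (0<i*j 0<θ (ℤ.+-mono-< 0<b₂ 0<c₂))
    ring₁ : ∀ b₂ c₂ θ β r →
      let S = b₂ * (β + θ) + c₂ * (θ + 1ℤ) in
      r * (S * S * (S * (+ 2 * (β - 1ℤ) * b₂))) - S * S * + 2 * b₂ * (θ * (b₂ + c₂)) * r ≡
      S * S * + 2 * b₂ * r * (S * (β - + 2) + (b₂ * β + c₂))
    ring₁ = solve-∀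
    ring₂ : ∀ S b₂ c₂ θ β K →
      S * S * + 2 * b₂ * (θ * (b₂ + c₂)) * (K * (β * β)) - θ * K * (S * (+ 2 * (β * b₂ + c₂)) * (S * (β * b₂))) ≡
      S * S * + 2 * b₂ * (θ * K) * β * (c₂ * (β - 1ℤ))
    ring₂ = solve-∀

  order<ramsey : ∀ r → K β * (β * β) < + r → order ℕ.< ramsey r
  order<ramsey r K<r = ℕ.≰⇒> λ ramsey≤ →
    let open Selected (select r (allFin order) (Unique.allFin⁺ order)
          (ℕ.≤-trans ramsey≤ (ℕ.≤-reflexive (sym (List.length-tabulate {n = order} (λ i → i))))))
    in ℤ.<⇒≱ K<r (subst (λ m → + m ≤ K β * (β * β)) size (pairs-bound distinct indistinguishable))

-- Enumeration of graphs

vectors : ∀ {A : Set} n → List A → List (Vector A n)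
vectors zero    xs = (λ ()) ∷ []
vectors (suc n) xs = cartesianProductWith Vector._∷_ xs (vectors n xs)

-- Vectors are functions, so membership in the list is meant up to pointwise R. A general R allows a
-- second application, to matrices as vectors of rows.
vectors⁺ : ∀ {A : Set} (R : A → A → Set) n {xs} (f : Vector A n) → (∀ i → Any (R (f i)) xs) →
           Any (λ g → ∀ i → R (f i) (g i)) (vectors n xs)
vectors⁺ R zero    f h = here (λ ())
vectors⁺ R (suc n) f h = Any.cartesianProductWith⁺ Vector._∷_
  (λ {x} {g} r rs → λ { zero → r ; (suc i) → rs i }) (h zero) (vectors⁺ R n (λ i → f (suc i)) (λ i → h (suc i)))

-- Forces an arbitrary Boolean matrix to be an adjacency matrix, so that all matrices can be
-- enumerated without filtering. A matrix that is already symmetric with false diagonal is left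
-- unchanged.
symmetrise : ∀ n → (Fin n → Fin n → Bool) → Graph
symmetrise n f = record
  { order     = n
  ; adj       = λ x y → (f x y ∧ f y x) ∧ not (does (x Fin.≟ y))
  ; symmetric = λ x y → cong₂ _∧_ (∧-comm (f x y) (f y x))
                  (cong not (does-⇔ (mk⇔ sym sym) (x Fin.≟ y) (y Fin.≟ x)))
  ; loopless  = λ x → trans (cong (λ b → (f x x ∧ f x x) ∧ not b) (dec-true (x Fin.≟ x) refl)) (∧-zeroʳ _)
  }

≅-symmetrise : ∀ Γ f → (∀ x y → Defs.adj Γ x y ≡ f x y) → Γ ≅ symmetrise (Defs.order Γ) f
≅-symmetrise Γ f adj≡f = record { bijection = ↔-id _ ; adj-preserved = preserved }
  where
  preserved : ∀ x y → (f x y ∧ f y x) ∧ not (does (x Fin.≟ y)) ≡ Defs.adj Γ x y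
  preserved x y rewrite sym (adj≡f x y) | sym (adj≡f y x) | Graph.symmetric Γ y x | ∧-idem (Defs.adj Γ x y)
    with x Fin.≟ y
  ... | yes refl = trans (∧-zeroʳ (Defs.adj Γ x x)) (sym (Graph.loopless Γ x))
  ... | no  _    = ∧-identityʳ (Defs.adj Γ x y)

graphs : ℕ → List Graph
graphs m = concatMap (λ n → map (symmetrise n) (vectors n (vectors n (true ∷ false ∷ [])))) (upTo m)

graphs⁺ : ∀ {m} Γ → Defs.order Γ ℕ.< m → Any (Γ ≅_) (graphs m)
graphs⁺ {m} Γ n<m = Any.concatMap⁺ _ (lose (∈-upTo⁺ n<m) (Any.map⁺
  (Any.map (λ {f} → ≅-symmetrise Γ f)
    (vectors⁺ (λ r s → ∀ i → r i ≡ s i) (Defs.order Γ) (Defs.adj Γ)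
      (λ x → vectors⁺ _≡_ (Defs.order Γ) (Defs.adj Γ x) (λ y → bool (Defs.adj Γ x y)))))))
  where
  bool : ∀ b → Any (b ≡_) (true ∷ false ∷ [])
  bool true  = here refl
  bool false = there (here refl)

-- The successor makes the number of requested pairs exceed the bound K β² strictly; the absolute
-- value avoids any discussion of its sign.
orderBound : ℤ → ℕ
orderBound β = ramsey (suc ℤ.∣ K β * (β * β) ∣)

i<1+∣i∣ : ∀ i → i < + suc ℤ.∣ i ∣
i<1+∣i∣ (+ n)    = +<+ (ℕ.n<1+n n)
i<1+∣i∣ -[1+ n ] = -<+

order<orderBound : ∀ Γ (s : IsShilla Γ) → + 2 ≤ IsShilla.b⟨Γ⟩ s → Defs.order Γ ℕ.< orderBound (IsShilla.b⟨Γ⟩ s)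
order<orderBound Γ s 2≤β = SpreadPairs.order<ramsey Γ (isDistanceRegular)
  (Eigenmatrix.eigenvalue⇒k≡θβ Γ isDistanceRegular (proj₁ a₃-secondLargest)) 2≤β _ (i<1+∣i∣ (K b⟨Γ⟩ * (b⟨Γ⟩ * b⟨Γ⟩)))
  where open IsShilla s

theorem9 : ∀ (β : ℤ) → + 2 ≤ β →
    FinitelyManyUpToIso (λ Γ → Σ (IsShilla Γ) (λ s → IsShilla.b⟨Γ⟩ s ≡ β))
theorem9 β 2≤β = graphs (orderBound β) , λ Γ (s , b≡β) → graphs⁺ Γ
  (subst (λ i → Defs.order Γ ℕ.< orderBound i) b≡β (order<orderBound Γ s (subst (+ 2 ≤_) (sym b≡β) 2≤β)))
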